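{- There exist absolute constants $c>0$ and $n_0$ such that for all integers $n\ge n_0$: (1) $$|E_1(n)|-\max_{\substack{A\in C_1(n)\\ A\not\subseteq E_1(n)}}|A|\ \ge\ c\,\frac{n}{(\log\log n)^{2}};$$ (2) $$|E_2(n)|-\max_{\substack{A\in C_2(n)\\ A\not\subseteq E_2(n)}}|A|\ \ge\ c\,\frac{n}{(\log\log n)^{5}}.$$
   Context: Let $\mathbb{Z}^{+}$ be the set of positive integers and $p_i$ the $i$th prime. For positive integers $k,n$: $C_k(n)$ is the family of all subsets $A\subseteq\{1,2,\ldots,n\}$ that do not contain $k+1$ (distinct) pairwise coprime integers; $E_k(n)$ is the set of positive integers not exceeding $n$ that are divisible by at least one of $p_1,\ldots,p_k$; $|A|$ denotes the number of elements of $A$. -}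

module Defs where

open import Algebra.Definitions.RawSemiring using () renaming (_^_ to pow)
open import Data.Bool using (if_then_else_)
open import Data.Fin using (Fin; toℕ)
open import Data.Fin.Properties using (any?)
open import Data.Fin.Subset using (Subset; _∈_; _⊆_; ∣_∣)
open import Data.Integer using (ℤ; +_)
open import Data.Nat as ℕ using (ℕ; zero; suc; _!)
open import Data.Nat.Coprimality using (Coprime)
open import Data.Nat.Divisibility using (_∣?_)
open import Data.Nat.Primality using (prime?)
open import Data.Product using (∃-syntax; _×_)
open import Data.Rational using (ℚ; 0ℚ; 1ℚ; _/_; _+_; _-_; _*_; _<_; +-*-rawSemiring)
open import Data.Sum using (_⊎_)
open import Data.Vec using (tabulate)
open import Relation.Binary.PropositionalEquality using (_≡_; _≢_)
open import Relation.Nullary using (¬_; does)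

-- Subsets of {1, …, n} are encoded as Subset n, with i : Fin n standing for
-- the integer toℕ i + 1.

value : ∀ {n} → Fin n → ℕ
value i = suc (toℕ i)

firstPrimeFrom : (fuel m : ℕ) → ℕ
firstPrimeFrom zero       m = m
firstPrimeFrom (suc fuel) m = if does (prime? m) then m else firstPrimeFrom fuel (suc m)

-- For n ≥ 1 there is a prime among n + 1, …, n! + 1 (Euclid), so the fuel
-- is never exhausted.
nextPrime : ℕ → ℕ
nextPrime n = firstPrimeFrom (n !) (suc n)

-- Counted from 0: nthPrime i is p_{i+1}.
nthPrime : ℕ → ℕ
nthPrime zero    = 2
nthPrime (suc i) = nextPrime (nthPrime i)

E : (k n : ℕ) → Subset n
E k n = tabulate λ j → does (any? {k} λ i → nthPrime (toℕ i) ∣? value j)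

PairwiseCoprime : ∀ {n} → Subset n → Set
PairwiseCoprime S = ∀ {i j} → i ∈ S → j ∈ S → i ≢ j → Coprime (value i) (value j)

C : (k n : ℕ) → Subset n → Set
C k n A = ¬ (∃[ S ] S ⊆ A × ∣ S ∣ ≡ suc k × PairwiseCoprime S)

IsMaxCard : ∀ {n} → (Subset n → Set) → ℕ → Set
IsMaxCard F M = (∃[ A ] F A × ∣ A ∣ ≡ M) × (∀ A → F A → ∣ A ∣ ℕ.≤ M)

-- Real numbers as two-sided Dedekind cuts of ℚ.  The operations below are
-- defined on arbitrary pairs of predicates; IsReal singles out the genuine
-- Dedekind reals.

record Cut : Set₁ where
  field
    lower upper : ℚ → Set

open Cut public

record IsReal (x : Cut) : Set where
  field
    lower-inhabited : ∃[ q ] lower x q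
    upper-inhabited : ∃[ q ] upper x q
    lower-closed    : ∀ {p q} → p < q → lower x q → lower x p
    upper-closed    : ∀ {p q} → p < q → upper x p → upper x q
    lower-open      : ∀ {p} → lower x p → ∃[ q ] p < q × lower x q
    upper-open      : ∀ {q} → upper x q → ∃[ p ] p < q × upper x p
    disjoint        : ∀ {q} → lower x q → ¬ upper x q
    located         : ∀ {p q} → p < q → lower x p ⊎ upper x q

infix 4 _≤ℝ_ _<ℝ_

_≤ℝ_ : Cut → Cut → Set
x ≤ℝ y = ∀ {q} → lower x q → lower y q

_<ℝ_ : Cut → Cut → Set
x <ℝ y = ∃[ q ] upper x q × lower y q

fromℚ : ℚ → Cut
fromℚ p = record { lower = _< p ; upper = p <_ }

fromℤ : ℤ → Cut
fromℤ z = fromℚ (z / 1)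

fromℕ : ℕ → Cut
fromℕ n = fromℤ (+ n)

infixl 7 _*ℝ_ _/ℝ_
infixr 8 _^ℝ_ _^_

-- Interval arithmetic: a < x < b and c < y < d, and xy is compared with the
-- four corner products.
_*ℝ_ : Cut → Cut → Cut
x *ℝ y = record
  { lower = λ q → ∃[ a ] ∃[ b ] ∃[ c ] ∃[ d ]
      (lower x a × upper x b × lower y c × upper y d) ×
      (q < a * c × q < a * d × q < b * c × q < b * d)
  ; upper = λ q → ∃[ a ] ∃[ b ] ∃[ c ] ∃[ d ]
      (lower x a × upper x b × lower y c × upper y d) ×
      (a * c < q × a * d < q × b * c < q × b * d < q)
  }

-- The reciprocal of a positive real; no meaning is intended for other
-- arguments.
recip : Cut → Cut
recip y = record
  { lower = λ q → ∃[ r ] 0ℚ < r × upper y r × q * r < 1ℚ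
  ; upper = λ q → ∃[ r ] 0ℚ < r × lower y r × 1ℚ < q * r
  }

_/ℝ_ : Cut → Cut → Cut
x /ℝ y = x *ℝ recip y

_^ℝ_ : Cut → ℕ → Cut
x ^ℝ zero  = fromℚ 1ℚ
x ^ℝ suc k = x *ℝ x ^ℝ k

_^_ : ℚ → ℕ → ℚ
_^_ = pow +-*-rawSemiring

-- exp q is the supremum of (1 + q/m)^m over m ≥ 1 with 1 + q/m > 0 (increasing
-- in m), and the infimum of (1 - q/m)^(-m) over m ≥ 1 with 1 - q/m > 0
-- (decreasing in m).  Below, m is suc k.
exp : ℚ → Cut
exp q = record
  { lower = λ r → ∃[ k ] 0ℚ < 1ℚ + q * (+ 1 / suc k) × r < (1ℚ + q * (+ 1 / suc k)) ^ suc k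
  ; upper = λ r → 0ℚ < r ×
      (∃[ k ] 0ℚ < 1ℚ - q * (+ 1 / suc k) × 1ℚ < r * (1ℚ - q * (+ 1 / suc k)) ^ suc k)
  }

-- The natural logarithm of a positive real, as the inverse of exp.
log : Cut → Cut
log x = record
  { lower = λ q → exp q <ℝ x
  ; upper = λ q → x <ℝ exp q
  }

module Submission where

-- Let m ∈ A be coprime to M, where M = 2 for k = 1 and M = 6 for k = 2.  Among
-- Mx + 1, …, Mx + M, the d elements Mx + b with b ∈ {1, 2} (resp. {1, 2, 3, 5})
-- are pairwise coprime, so that A contains at most k of them and hence at most as
-- many elements of this block as E k n does.  If all d of them are coprime to m,
-- then A contains at most k − 1 of them, and one element is gained.  It remains
-- to find n / (log log n)ᵈ such blocks, up to a constant.  Here d is 2 (resp. 4);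
-- thus for k = 2 the exponent obtained is 4 rather than 5.
--
-- With Z of order log n, the product P of the primes in (d, Z] is at most 4 ^ Z,
-- a small power of n, so that sieving by these primes is exactly periodic
-- modulo P and leaves the proportion ∏ (1 − d/p).  By Chebyshev's and Mertens'
-- arguments this is at least a constant times (log Z)⁻ᵈ.  The prime factors of m
-- above Z number at most a constant times (log n)/(log Z), and remove only a
-- small proportion of each residue class modulo P.

open import Data.Bool using (Bool; true; false; if_then_else_; _∧_; _∨_; not)
open import Data.Bool.Properties using (∧-identityʳ)
open import Data.Empty using (⊥; ⊥-elim)
open import Data.Fin as Fin using (Fin; toℕ)
open import Data.Fin.Properties as Fin using (any?; toℕ<n; toℕ-fromℕ<; all?)
open import Data.Fin.Subset using (Subset; _∪_; ⁅_⁆; _⊆_; _⊈_; ∣_∣) renaming (_∈_ to _∈ₛ_; _∉_ to _∉ₛ_)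
open import Data.Fin.Subset.Properties using (_∈?_; x∈p∪q⁻; x∈⁅y⁆⇒x≡y; ∪-identityˡ; ∣⁅x⁆∣≡1; _⊆?_; anySubset?; ∣p∣≤n; p⊆q⇒∣p∣≤∣q∣; x∈⁅x⁆)
open import Data.List using (List; []; _∷_; length; filter)
open import Data.List.Membership.Propositional using (_∈_)
open import Data.List.Membership.Propositional.Properties using (∈-filter⁺; ∈-filter⁻)
open import Data.List.Properties using (filter-accept; filter-reject)
open import Data.List.Relation.Unary.All as All using (All; []; _∷_)
open import Data.List.Relation.Unary.Any using (here; there)
open import Data.Nat using (ℕ; zero; suc; _≤_; _<_; _+_; _*_; _∸_; _!; _/_; _%_; _^_; z≤n; s≤s; s≤s⁻¹; NonZero; ≢-nonZero; ≢-nonZero⁻¹; >-nonZero; >-nonZero⁻¹; _<?_; _≤?_; _≟_)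
open import Data.Nat.Combinatorics using (k![n∸k]!∣n!)
open import Data.Nat.Coprimality using (Coprime; coprime?; 1-coprimeTo) renaming (sym to coprime-sym)
open import Data.Nat.DivMod using (m/n*n≤m; m≡m%n+[m/n]*n; m%n<n; /-monoˡ-≤; +-distrib-/-∣ˡ; m*n/n≡m; n/1≡n; m*n/o*n≡m/o; m≥n⇒m/n>0)
open import Data.Nat.Divisibility using (_∣_; _∤_; _∣?_; divides; ∣-trans; ∣-refl; ∣⇒≤; ∣1⇒≡1; m≤n⇒m!∣n!; m∣m*n; n∣m*n; ∣m+n∣m⇒∣n; ∣m∣n⇒∣m+n; ∣n⇒∣m*n; ∣m⇒∣m*n; 1∣_; >⇒∤; 0∣⇒≡0)
open import Data.Nat.ListAction using (product)
open import Data.Nat.ListAction.Properties using (∈⇒∣product)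
open import Data.Nat.Primality using (Prime; prime?; euclidsLemma; prime⇒nonZero; prime⇒irreducible; prime⇒¬composite; composite[4]; prime[2])
open import Data.Nat.Primality.Factorisation using (factorise; PrimeFactorisation; factorisationHasAllPrimeFactors)
open import Data.Nat.Properties
open import Data.Nat.Tactic.RingSolver using (solve-∀)
open import Data.Product using (∃-syntax; _×_; _,_; proj₁; proj₂)
open import Data.Sum using (_⊎_; inj₁; inj₂)
open import Data.Vec using ([]; _∷_; tabulate; here; there)
open import Data.Vec.Properties using (lookup⇒[]=; lookup∘tabulate; []=⇒lookup)
open import Defs hiding (_^_)
open import Function using (_∘_)
open import Relation.Binary.PropositionalEquality using (_≡_; _≢_; refl; sym; trans; cong; cong₂; subst; subst₂)
open import Relation.Nullary using (¬_; Dec; yes; no; does; contradiction; ¬?)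
open import Relation.Nullary.Decidable using (_×-dec_; _→-dec_; map′)

-- Finite sums and products

-- Every prime in (d, Z] is sieved out, whether or not it divides m, so that the count depends on m
-- only through its prime factors above Z. Including those in the period could push it beyond n;
-- instead a union bound treats them inside each class modulo P. This needs many periods, which
-- limits Z from above, and few such factors, which limits it from below: hence Z of order log n.
-- Primes up to d cause no trouble: m lies outside `E k n`, so its prime factors exceed d, and for p
-- > d the d forms leave at least p - d > 0 classes modulo p. The blocks of A lie one block further
-- than those of `E k n`. This excludes the number 1, which is coprime to itself and could coincide
-- with m. All estimates take place in ℕ: logarithms become dyadic exponents or powers of 1 + 1/D.
-- Only at the end does log log n enter, by e^e^b ≤ 4^4^b ≤ n with b = a + 1 and Z = 4^b.

∑ ∏ : ℕ → (ℕ → ℕ) → ℕ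
∑ zero    f = 0
∑ (suc n) f = ∑ n f + f n
∏ zero    f = 1
∏ (suc n) f = ∏ n f * f n

∑-cong : ∀ n {f g} → (∀ i → i < n → f i ≡ g i) → ∑ n f ≡ ∑ n g
∑-cong zero    h = refl
∑-cong (suc n) h = cong₂ _+_ (∑-cong n λ i i<n → h i (m<n⇒m<1+n i<n)) (h n (n<1+n n))

∑-mono : ∀ n {f g} → (∀ i → i < n → f i ≤ g i) → ∑ n f ≤ ∑ n g
∑-mono zero    h = z≤n
∑-mono (suc n) h = +-mono-≤ (∑-mono n λ i i<n → h i (m<n⇒m<1+n i<n)) (h n (n<1+n n))

∑-distrib-+ : ∀ n f g → ∑ n (λ i → f i + g i) ≡ ∑ n f + ∑ n g
∑-distrib-+ zero    f g = refl
∑-distrib-+ (suc n) f g = trans (cong (_+ (f n + g n)) (∑-distrib-+ n f g)) (eq (∑ n f) (∑ n g) (f n) (g n))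
  where
  eq : ∀ a b c d → (a + b) + (c + d) ≡ (a + c) + (b + d)
  eq = solve-∀

∑-distrib-* : ∀ n c f → ∑ n (λ i → c * f i) ≡ c * ∑ n f
∑-distrib-* zero    c f = sym (*-zeroʳ c)
∑-distrib-* (suc n) c f = trans (cong (_+ c * f n) (∑-distrib-* n c f)) (sym (*-distribˡ-+ c (∑ n f) (f n)))

∑-const : ∀ n c → ∑ n (λ _ → c) ≡ n * c
∑-const zero    c = refl
∑-const (suc n) c = trans (cong (_+ c) (∑-const n c)) (+-comm (n * c) c)

∑-split : ∀ m n f → ∑ (m + n) f ≡ ∑ m f + ∑ n (λ i → f (m + i))
∑-split m zero    f = trans (cong (λ k → ∑ k f) (+-identityʳ m)) (sym (+-identityʳ _))
∑-split m (suc n) f = trans (cong (λ k → ∑ k f) (+-suc m n))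
  (trans (cong (_+ f (m + n)) (∑-split m n f)) (+-assoc (∑ m f) _ _))

∑-monoˡ : ∀ {m n} f → m ≤ n → ∑ m f ≤ ∑ n f
∑-monoˡ {m} {n} f m≤n = subst (λ k → ∑ m f ≤ ∑ k f) (m+[n∸m]≡n m≤n)
  (≤-trans (m≤m+n _ _) (≤-reflexive (sym (∑-split m (n ∸ m) f))))

∑-blocks : ∀ c p f → ∑ (c * p) f ≡ ∑ c (λ b → ∑ p (λ i → f (b * p + i)))
∑-blocks zero    p f = refl
∑-blocks (suc c) p f = trans (cong (λ k → ∑ k f) (+-comm p (c * p)))
  (trans (∑-split (c * p) p f) (cong (_+ ∑ p (λ i → f (c * p + i))) (∑-blocks c p f)))

∑-swap : ∀ m n (f : ℕ → ℕ → ℕ) → ∑ m (λ i → ∑ n (f i)) ≡ ∑ n (λ j → ∑ m (λ i → f i j))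
∑-swap zero    n f = sym (trans (∑-const n 0) (*-zeroʳ n))
∑-swap (suc m) n f = trans (cong (_+ ∑ n (f m)) (∑-swap m n f))
  (sym (∑-distrib-+ n (λ j → ∑ m (λ i → f i j)) (f m)))

∑-zero : ∀ n {f} → (∀ i → i < n → f i ≡ 0) → ∑ n f ≡ 0
∑-zero n h = trans (∑-cong n h) (trans (∑-const n 0) (*-zeroʳ n))

∑-≤1 : ∀ n {f} → (∀ i → i < n → f i ≤ 1) →
       (∀ i j → i < j → j < n → 1 ≤ f i → 1 ≤ f j → ⊥) → ∑ n f ≤ 1
∑-≤1 zero        h u = z≤n
∑-≤1 (suc n) {f} h u with f n in eq
... | zero  = subst (_≤ 1) (sym (+-identityʳ _))
                (∑-≤1 n (λ i i<n → h i (m<n⇒m<1+n i<n)) (λ i j i<j j<n → u i j i<j (m<n⇒m<1+n j<n)))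
... | suc k = subst (_≤ 1) (sym (cong (_+ suc k) (∑-zero n vanish))) (subst (_≤ 1) eq (h n (n<1+n n)))
  where
  vanish : ∀ i → i < n → f i ≡ 0
  vanish i i<n with f i in eq′
  ... | zero  = refl
  ... | suc _ = ⊥-elim (u i n i<n (n<1+n n) (subst (1 ≤_) (sym eq′) (s≤s z≤n)) (subst (1 ≤_) (sym eq) (s≤s z≤n)))

term≤∑ : ∀ n f {i} → i < n → f i ≤ ∑ n f
term≤∑ (suc n) f {i} i<1+n with m<1+n⇒m<n∨m≡n i<1+n
... | inj₁ i<n  = ≤-trans (term≤∑ n f i<n) (m≤m+n _ _)
... | inj₂ refl = m≤n+m _ _

∏-mono : ∀ n {f g} → (∀ i → i < n → f i ≤ g i) → ∏ n f ≤ ∏ n g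
∏-mono zero    h = ≤-refl
∏-mono (suc n) h = *-mono-≤ (∏-mono n λ i i<n → h i (m<n⇒m<1+n i<n)) (h n (n<1+n n))

∏-split : ∀ m n f → ∏ (m + n) f ≡ ∏ m f * ∏ n (λ i → f (m + i))
∏-split m zero    f = trans (cong (λ k → ∏ k f) (+-identityʳ m)) (sym (*-identityʳ _))
∏-split m (suc n) f = trans (cong (λ k → ∏ k f) (+-suc m n))
  (trans (cong (_* f (m + n)) (∏-split m n f)) (*-assoc (∏ m f) _ _))

∏-^ : ∀ n b f → ∏ n (λ i → b ^ f i) ≡ b ^ ∑ n f
∏-^ zero    b f = refl
∏-^ (suc n) b f = trans (cong (_* b ^ f n) (∏-^ n b f)) (sym (^-distribˡ-+-* b (∑ n f) (f n)))

^-distribʳ-* : ∀ k a b → (a * b) ^ k ≡ a ^ k * b ^ k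
^-distribʳ-* zero    a b = refl
^-distribʳ-* (suc k) a b = trans (cong (a * b *_) (^-distribʳ-* k a b)) (arrange a b (a ^ k) (b ^ k))
  where
  arrange : ∀ a b c d → (a * b) * (c * d) ≡ (a * c) * (b * d)
  arrange = solve-∀

∏≥1 : ∀ n {f} → (∀ i → i < n → 1 ≤ f i) → 1 ≤ ∏ n f
∏≥1 zero    h = ≤-refl
∏≥1 (suc n) h = *-mono-≤ (∏≥1 n λ i i<n → h i (m<n⇒m<1+n i<n)) (h n (n<1+n n))

∣∏ : ∀ n f {i} → i < n → ∃[ q ] ∏ n f ≡ q * f i
∣∏ (suc n) f {i} i<1+n with m<1+n⇒m<n∨m≡n i<1+n
... | inj₂ refl = ∏ n f , refl
... | inj₁ i<n with ∣∏ n f i<n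
...   | q , eq = q * f n , trans (cong (_* f n) eq) (comm q (f i) (f n))
  where
  comm : ∀ a b c → a * b * c ≡ a * c * b
  comm = solve-∀

-- Products of primes and Chebyshev's bound

pick : Bool → ℕ → ℕ
pick b x = if b then x else 1

𝟙 : Bool → ℕ
𝟙 true  = 1
𝟙 false = 0

does-true : ∀ {P : Set} (P? : Dec P) → does P? ≡ true → P
does-true (yes p) _ = p

true-does : ∀ {P : Set} (P? : Dec P) → P → does P? ≡ true
true-does (yes _) _ = refl
true-does (no ¬p) p = contradiction p ¬p

∧-true : ∀ {a b} → a ∧ b ≡ true → a ≡ true × b ≡ true
∧-true {true} {true} _ = refl , refl

OnlyPrimes : (ℕ → Bool) → Set
OnlyPrimes s = ∀ i → s i ≡ true → Prime (suc i)

-- A selector s speaks about suc i, so that the range i < n covers 1, …, n.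
primeProd : (ℕ → Bool) → ℕ → ℕ → ℕ
primeProd s a n = ∏ n (λ i → pick (s (a + i)) (suc (a + i)))

prime≢1 : ∀ {p} → Prime p → p ∤ 1
prime≢1 pp p∣1 with ∣1⇒≡1 p∣1
prime≢1 () p∣1 | refl

prime≥2 : ∀ {p} → Prime p → 2 ≤ p
prime≥2 {zero}        pp = ⊥-elim (≢-nonZero⁻¹ 0 {{prime⇒nonZero pp}} refl)
prime≥2 {suc zero}    pp = ⊥-elim (prime≢1 pp ∣-refl)
prime≥2 {suc (suc p)} pp = s≤s (s≤s z≤n)

prime∣prime : ∀ {p q} → Prime p → Prime q → p ∣ q → p ≡ q
prime∣prime pp pq p∣q with prime⇒irreducible pq p∣q
... | inj₁ refl = ⊥-elim (prime≢1 pp ∣-refl)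
... | inj₂ eq   = eq

prime∣primeProd : ∀ {s} → OnlyPrimes s → ∀ a n {p} → Prime p → p ∣ primeProd s a n → ∃[ i ] i < n × s (a + i) ≡ true × p ≡ suc (a + i)
prime∣primeProd     os a zero    pp p∣ = ⊥-elim (prime≢1 pp p∣)
prime∣primeProd {s} os a (suc n) pp p∣ with euclidsLemma _ (pick (s (a + n)) (suc (a + n))) pp p∣
... | inj₁ p∣Π with prime∣primeProd os a n pp p∣Π
...   | i , i<n , si , eq = i , m<n⇒m<1+n i<n , si , eq
prime∣primeProd {s} os a (suc n) pp p∣ | inj₂ p∣n with s (a + n) in eq
... | true  = n , n<1+n n , eq , prime∣prime pp (os _ eq) p∣n
... | false = ⊥-elim (prime≢1 pp p∣n)

-- Write k = q R with R the product so far. The new prime divides q R but not R, whose prime factors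
-- are smaller selected primes; hence it divides q.
primeProd∣ : ∀ {s} → OnlyPrimes s → ∀ a n {k} →
             (∀ i → i < n → s (a + i) ≡ true → suc (a + i) ∣ k) → primeProd s a n ∣ k
primeProd∣     os a zero    h = 1∣ _
primeProd∣ {s} os a (suc n) {k} h with s (a + n) in eq
... | false = subst (_∣ k) (sym (*-identityʳ _)) (primeProd∣ os a n λ i i<n → h i (m<n⇒m<1+n i<n))
... | true  with primeProd∣ os a n {k} (λ i i<n → h i (m<n⇒m<1+n i<n)) | h n (n<1+n n) eq
...   | divides q refl | p∣k with euclidsLemma q (primeProd s a n) (os _ eq) p∣k
...     | inj₁ (divides r refl) = divides r (arrange r (suc (a + n)) _)
  where
  arrange : ∀ r p R → r * p * R ≡ r * (R * p)
  arrange = solve-∀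
...     | inj₂ p∣R with prime∣primeProd os a n (os _ eq) p∣R
...       | i , i<n , _ , e = contradiction (+-cancelˡ-≡ a n i (suc-injective e)) (λ n≡i → <⇒≢ i<n (sym n≡i))

∣primeProd : ∀ s a n {i} → i < n → s (a + i) ≡ true → suc (a + i) ∣ primeProd s a n
∣primeProd s a n {i} i<n si with ∣∏ n (λ i → pick (s (a + i)) (suc (a + i))) i<n
... | q , eq rewrite si = divides q eq

pick≥1 : ∀ b {x} → 1 ≤ pick b (suc x)
pick≥1 true  = s≤s z≤n
pick≥1 false = ≤-refl

primeProd≥1 : ∀ s a n → 1 ≤ primeProd s a n
primeProd≥1 s a n = ∏≥1 n λ i _ → pick≥1 (s (a + i))

prime∤n! : ∀ {p} → Prime p → ∀ n → n < p → p ∤ n !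
prime∤n! pp zero    n<p p∣ = prime≢1 pp p∣
prime∤n! pp (suc n) n<p p∣ with euclidsLemma (suc n) (n !) pp p∣
... | inj₁ p∣n  = >⇒∤ n<p p∣n
... | inj₂ p∣n! = prime∤n! pp n (<-trans (n<1+n n) n<p) p∣n!

-- The central binomial coefficient is at most 4^n: each step replaces (2n + 1)(2n + 2) by (2n + 2)²
-- = 4 (n + 1)².
[2n]!≤4^n*n!² : ∀ n → (n + n) ! ≤ 4 ^ n * (n ! * n !)
[2n]!≤4^n*n!² zero    = ≤-refl
[2n]!≤4^n*n!² (suc n) = begin
  (suc n + suc n) !                                   ≡⟨ cong (λ k → suc k !) (+-suc n n) ⟩
  suc (suc (n + n)) * (suc (n + n) * (n + n) !)       ≤⟨ *-monoʳ-≤ (suc (suc (n + n))) (*-mono-≤ (n≤1+n (suc (n + n))) ([2n]!≤4^n*n!² n)) ⟩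
  suc (suc (n + n)) * (suc (suc (n + n)) * (4 ^ n * (n ! * n !))) ≡⟨ arrange n (4 ^ n) (n !) ⟩
  4 * 4 ^ n * (suc n * n ! * (suc n * n !))           ∎
  where
  open ≤-Reasoning
  arrange : ∀ n x f → (2 + (n + n)) * ((2 + (n + n)) * (x * (f * f))) ≡ 4 * x * ((1 + n) * f * ((1 + n) * f))
  arrange = solve-∀

-- A prime in (n, 2n] divides (2n)! but not n!, hence it divides the central binomial coefficient
-- `B`.
primeProd-block≤4^ : ∀ {s} → OnlyPrimes s → ∀ n → primeProd s n n ≤ 4 ^ n
primeProd-block≤4^ {s} os n with subst (λ k → n ! * k ! ∣ (n + n) !) (m+n∸n≡m n n) (k![n∸k]!∣n! (m≤n+m n n))
... | divides B eq = ≤-trans (∣⇒≤ {{nz}} (primeProd∣ os n n p∣B)) B≤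
  where
  instance
    n!²≢0 : NonZero (n ! * n !)
    n!²≢0 = n !* n !≢0
  B≤ : B ≤ 4 ^ n
  B≤ = *-cancelʳ-≤ B (4 ^ n) (n ! * n !) (subst (_≤ 4 ^ n * (n ! * n !)) eq ([2n]!≤4^n*n!² n))
  nz : NonZero B
  nz = ≢-nonZero λ { refl → ≢-nonZero⁻¹ _ {{(n + n) !≢0}} eq }
  p∣B : ∀ i → i < n → s (n + i) ≡ true → suc (n + i) ∣ B
  p∣B i i<n si with euclidsLemma B (n ! * n !) (os _ si)
    (subst (suc (n + i) ∣_) eq (∣-trans (m∣m*n _) (m≤n⇒m!∣n! (+-monoʳ-< n i<n))))
  ... | inj₁ d = d
  ... | inj₂ d with euclidsLemma (n !) (n !) (os _ si) d
  ...   | inj₁ d′ = ⊥-elim (prime∤n! (os _ si) n (s≤s (m≤m+n n i)) d′)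
  ...   | inj₂ d′ = ⊥-elim (prime∤n! (os _ si) n (s≤s (m≤m+n n i)) d′)

2^[1+K] : ∀ K → 2 ^ suc K ≡ 2 ^ K + 2 ^ K
2^[1+K] K = cong (2 ^ K +_) (+-identityʳ (2 ^ K))

pick-1 : ∀ b → pick b 1 ≡ 1
pick-1 true  = refl
pick-1 false = refl

-- At powers of two the exponents of the lower half and of the block above it add up exactly to that
-- of the whole range.
primeProd≤4^ : ∀ {s} → OnlyPrimes s → ∀ K → primeProd s 0 (2 ^ K) ≤ 4 ^ 2 ^ K
primeProd≤4^ {s} os zero = subst (_≤ 4) (sym (trans (*-identityˡ _) (pick-1 (s 0)))) (s≤s z≤n)
primeProd≤4^ {s} os (suc K) = begin
  primeProd s 0 (2 ^ suc K)             ≡⟨ cong (primeProd s 0) (2^[1+K] K) ⟩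
  primeProd s 0 (2 ^ K + 2 ^ K)         ≡⟨ ∏-split (2 ^ K) (2 ^ K) _ ⟩
  primeProd s 0 (2 ^ K) * primeProd s (2 ^ K) (2 ^ K)
                                        ≤⟨ *-mono-≤ (primeProd≤4^ os K) (primeProd-block≤4^ os (2 ^ K)) ⟩
  4 ^ 2 ^ K * 4 ^ 2 ^ K                 ≡⟨ ^-distribˡ-+-* 4 (2 ^ K) (2 ^ K) ⟨
  4 ^ (2 ^ K + 2 ^ K)                   ≡⟨ cong (4 ^_) (2^[1+K] K) ⟨
  4 ^ 2 ^ suc K                         ∎
  where open ≤-Reasoning

-- Mertens' theorem: the sum of 1/p

-- Dyadic blocks covering 1 ≤ i < 2^K. The index 0, standing for the number 1, lies in none of them.
∑₂ : ℕ → (ℕ → ℕ) → ℕ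
∑₂ K g = ∑ K (λ j → ∑ (2 ^ j) (λ i → g (2 ^ j + i)))

-- The weight of i with 2 ^ j ≤ i < 2 ^ suc j is j = ⌊log₂ i⌋.
∑log : ℕ → (ℕ → ℕ) → ℕ
∑log K g = ∑ K (λ j → j * ∑ (2 ^ j) (λ i → g (2 ^ j + i)))

∑-dyadic : ∀ K g → ∑ (2 ^ K) g ≡ g 0 + ∑₂ K g
∑-dyadic zero    g = sym (+-identityʳ (g 0))
∑-dyadic (suc K) g = trans (cong (λ n → ∑ n g) (2^[1+K] K))
  (trans (∑-split (2 ^ K) (2 ^ K) g)
  (trans (cong (_+ ∑ (2 ^ K) (λ i → g (2 ^ K + i))) (∑-dyadic K g)) (+-assoc (g 0) _ _)))

∑log-mono : ∀ K {f g} → (∀ i → f i ≤ g i) → ∑log K f ≤ ∑log K g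
∑log-mono K h = ∑-mono K λ j _ → *-monoʳ-≤ j (∑-mono (2 ^ j) λ i _ → h _)

∑log-distrib-+ : ∀ K f g → ∑log K (λ i → f i + g i) ≡ ∑log K f + ∑log K g
∑log-distrib-+ K f g = trans
  (∑-cong K λ j _ → trans (cong (j *_) (∑-distrib-+ (2 ^ j) _ _)) (*-distribˡ-+ j _ _))
  (∑-distrib-+ K _ _)

∑log-distrib-* : ∀ K c f → ∑log K (λ i → c * f i) ≡ c * ∑log K f
∑log-distrib-* K c f = trans
  (∑-cong K λ j _ → trans (cong (j *_) (∑-distrib-* (2 ^ j) c _)) (arrange j c _))
  (∑-distrib-* K c _)
  where
  arrange : ∀ a b c → a * (b * c) ≡ b * (a * c)
  arrange = solve-∀

∑log-swap : ∀ n K (f : ℕ → ℕ → ℕ) → ∑ n (λ k → ∑log K (f k)) ≡ ∑log K (λ i → ∑ n (λ k → f k i))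
∑log-swap n K f = trans (∑-swap n K _) (∑-cong K λ j _ →
  trans (∑-distrib-* n j _) (cong (j *_) (∑-swap n (2 ^ j) _)))

2^-cancel-≤ : ∀ {a b} → 2 ^ a ≤ 2 ^ b → a ≤ b
2^-cancel-≤ {a} {b} h with a ≤? b
... | yes a≤b = a≤b
... | no  a≰b = contradiction h (<⇒≱ (^-monoʳ-< 2 (s≤s (s≤s z≤n)) (≰⇒> a≰b)))

-- A selected `suc i` with i in block j exceeds 2^j. The left exponent is thus a lower
-- approximation, in base 2, of the sum of log p (Chebyshev's θ).
2^∑log≤primeProd : ∀ s K → 2 ^ ∑log K (λ i → 𝟙 (s i)) ≤ primeProd s 0 (2 ^ K)
2^∑log≤primeProd s zero    = subst (1 ≤_) (sym (trans (*-identityˡ _) (pick-1 (s 0)))) ≤-refl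
2^∑log≤primeProd s (suc K) = begin
  2 ^ (∑log K f + K * ∑ N (λ i → f (N + i)))     ≡⟨ ^-distribˡ-+-* 2 (∑log K f) _ ⟩
  2 ^ ∑log K f * 2 ^ (K * ∑ N (λ i → f (N + i)))   ≤⟨ *-mono-≤ (2^∑log≤primeProd s K) block ⟩
  primeProd s 0 N * primeProd s N N           ≡⟨ ∏-split N N _ ⟨
  primeProd s 0 (N + N)                       ≡⟨ cong (primeProd s 0) (2^[1+K] K) ⟨
  primeProd s 0 (2 ^ suc K)                   ∎
  where
  open ≤-Reasoning
  N = 2 ^ K
  f : ℕ → ℕ
  f i = 𝟙 (s i)
  term : ∀ b i → N ^ 𝟙 b ≤ pick b (suc (N + i))
  term true  i = subst (_≤ suc (N + i)) (sym (*-identityʳ N)) (m≤n⇒m≤1+n (m≤m+n N i))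
  term false i = ≤-refl
  block : 2 ^ (K * ∑ N (λ i → f (N + i))) ≤ primeProd s N N
  block = begin
    2 ^ (K * ∑ N (λ i → f (N + i)))  ≡⟨ ^-*-assoc 2 K _ ⟨
    N ^ ∑ N (λ i → f (N + i))        ≡⟨ ∏-^ N N _ ⟨
    ∏ N (λ i → N ^ f (N + i))        ≤⟨ ∏-mono N (λ i _ → term (s (N + i)) i) ⟩
    primeProd s N N                  ∎

∑log-primes≤ : ∀ {s} → OnlyPrimes s → ∀ K → ∑log K (λ i → 𝟙 (s i)) ≤ 2 * 2 ^ K
∑log-primes≤ {s} os K = 2^-cancel-≤ (begin
  2 ^ ∑log K (λ i → 𝟙 (s i))  ≤⟨ 2^∑log≤primeProd s K ⟩
  primeProd s 0 (2 ^ K)       ≤⟨ primeProd≤4^ os K ⟩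
  (2 ^ 2) ^ 2 ^ K             ≡⟨ ^-*-assoc 2 2 (2 ^ K) ⟩
  2 ^ (2 * 2 ^ K)             ∎)
  where open ≤-Reasoning

divisor : (ℕ → Bool) → ℕ → ℕ → Bool
divisor s k i = s i ∧ does (suc i ∣? k)

-- The distinct selected primes dividing `suc k` have a product that divides `suc k`, hence is at
-- most 2^K.
∑log-divisors≤ : ∀ {s} → OnlyPrimes s → ∀ K k → suc k ≤ 2 ^ K → ∑log K (λ i → 𝟙 (divisor s (suc k) i)) ≤ K
∑log-divisors≤ {s} os K k k<2^K = 2^-cancel-≤
  (≤-trans (2^∑log≤primeProd (divisor s (suc k)) K)
  (≤-trans (∣⇒≤ (primeProd∣ {divisor s (suc k)} (λ i e → os i (proj₁ (∧-true e))) 0 (2 ^ K)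
                  (λ i _ e → does-true (suc i ∣? suc k) (proj₂ (∧-true {s i} e)))))
           k<2^K))

multiples : ℕ → ℕ → ℕ
multiples p n = ∑ n (λ k → 𝟙 (does (p ∣? suc k)))

𝟙≤1 : ∀ b → 𝟙 b ≤ 1
𝟙≤1 true  = ≤-refl
𝟙≤1 false = z≤n

m≤[1+m/n]*n : ∀ m n .{{_ : NonZero n}} → m ≤ suc (m / n) * n
m≤[1+m/n]*n m n = ≤-trans (≤-reflexive (m≡m%n+[m/n]*n m n)) (+-monoˡ-≤ (m / n * n) (<⇒≤ (m%n<n m n)))

m≤n*[1+m/n] : ∀ m n .{{_ : NonZero n}} → m ≤ n * suc (m / n)
m≤n*[1+m/n] m n = ≤-trans (m≤[1+m/n]*n m n) (≤-reflexive (*-comm (suc (m / n)) n))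

-- Every full block of `suc p` indices ends in a multiple; the incomplete block is paid for by the
-- additional 1.
multiples-lower : ∀ p n → n ≤ suc p * suc (multiples (suc p) n)
multiples-lower p′ n = begin
  n                         ≡⟨ m≡m%n+[m/n]*n n p ⟩
  n % p + n / p * p         ≤⟨ +-mono-≤ (<⇒≤ (m%n<n n p)) (*-monoˡ-≤ p count) ⟩
  p + multiples p n * p     ≡⟨ *-comm (suc (multiples p n)) p ⟩
  p * suc (multiples p n)   ∎
  where
  open ≤-Reasoning
  p = suc p′
  last∣ : ∀ b → 1 ≤ 𝟙 (does (p ∣? suc (b * p + p′)))
  last∣ b = subst (λ c → 1 ≤ 𝟙 c)
    (sym (true-does (p ∣? _) (subst (p ∣_) (+-suc (b * p) p′) (∣m∣n⇒∣m+n (n∣m*n b) ∣-refl)))) ≤-refl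
  count : n / p ≤ multiples p n
  count = begin
    n / p                                                    ≡⟨ *-identityʳ (n / p) ⟨
    n / p * 1                                                ≡⟨ ∑-const (n / p) 1 ⟨
    ∑ (n / p) (λ _ → 1)                                      ≤⟨ ∑-mono (n / p) (λ b _ → ≤-trans (last∣ b) (term≤∑ p _ (n<1+n p′))) ⟩
    ∑ (n / p) (λ b → ∑ p (λ i → 𝟙 (does (p ∣? suc (b * p + i))))) ≡⟨ ∑-blocks (n / p) p _ ⟨
    multiples p (n / p * p)                                  ≤⟨ ∑-monoˡ _ (m/n*n≤m n p) ⟩
    multiples p n                                            ∎

-- A large D replaces rational arithmetic: D / p stands for 1 / p.
inv : ℕ → (ℕ → Bool) → ℕ → ℕ
inv D s i = if s i then D / suc i else 0

inv≤ : ∀ D s i → inv D s i ≤ D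
inv≤ D s i with s i
... | true  = ≤-trans (m≤m*n _ (suc i)) (m/n*n≤m D (suc i))
... | false = z≤n

-- The sum of (log p)/p, by double counting pairs p ∣ k with k ≤ N. Each k carries weight at most K;
-- each p has at least N/p - 1 multiples, and the missing 1 costs Chebyshev's 2 N.
mertens-log : ∀ {s} → OnlyPrimes s → ∀ D K → ∑log K (inv D s) ≤ D * (K + 2)
mertens-log {s} os D K = *-cancelˡ-≤ N (begin
  N * ∑log K (inv D s)                       ≡⟨ ∑log-distrib-* K N (inv D s) ⟨
  ∑log K (λ i → N * inv D s i)               ≤⟨ ∑log-mono K pointwise ⟩
  ∑log K (λ i → D * (cnt i + 𝟙 (s i)))       ≡⟨ ∑log-distrib-* K D (λ i → cnt i + 𝟙 (s i)) ⟩
  D * ∑log K (λ i → cnt i + 𝟙 (s i))         ≡⟨ cong (D *_) (∑log-distrib-+ K cnt (λ i → 𝟙 (s i))) ⟩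
  D * (∑log K cnt + ∑log K (λ i → 𝟙 (s i)))  ≤⟨ *-monoʳ-≤ D (+-mono-≤ cnt≤ (∑log-primes≤ os K)) ⟩
  D * (N * K + 2 * N)                        ≡⟨ arrange D N K ⟩
  N * (D * (K + 2))                          ∎)
  where
  open ≤-Reasoning
  N = 2 ^ K
  instance
    N≢0 : NonZero N
    N≢0 = m^n≢0 2 K
  cnt : ℕ → ℕ
  cnt i = ∑ N (λ k → 𝟙 (divisor s (suc k) i))
  arrange : ∀ D N K → D * (N * K + 2 * N) ≡ N * (D * (K + 2))
  arrange = solve-∀
  cnt≤ : ∑log K cnt ≤ N * K
  cnt≤ = begin
    ∑log K cnt                                        ≡⟨ ∑log-swap N K (λ k i → 𝟙 (divisor s (suc k) i)) ⟨
    ∑ N (λ k → ∑log K (λ i → 𝟙 (divisor s (suc k) i))) ≤⟨ ∑-mono N (λ k k<N → ∑log-divisors≤ os K k k<N) ⟩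
    ∑ N (λ _ → K)                                     ≡⟨ ∑-const N K ⟩
    N * K                                             ∎
  pointwise : ∀ i → N * inv D s i ≤ D * (cnt i + 𝟙 (s i))
  pointwise i with s i
  ... | false = ≤-trans (≤-reflexive (*-zeroʳ N)) z≤n
  ... | true  = begin
    N * (D / suc i)                              ≤⟨ *-monoˡ-≤ (D / suc i) (multiples-lower i N) ⟩
    suc i * suc (multiples (suc i) N) * (D / suc i) ≡⟨ arrange′ (suc i) _ (D / suc i) ⟩
    D / suc i * suc i * (multiples (suc i) N + 1) ≤⟨ *-monoˡ-≤ (multiples (suc i) N + 1) (m/n*n≤m D (suc i)) ⟩
    D * (multiples (suc i) N + 1)                ∎
    where
    arrange′ : ∀ p m q → p * (1 + m) * q ≡ q * p * (m + 1)
    arrange′ = solve-∀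

-- An upper bound for D times the harmonic number: the `suc` makes each rounded term exceed D/(i +
-- 1).
harmonic : ℕ → ℕ → ℕ
harmonic D k = ∑ k (λ i → suc (D / suc i))

-- Abel summation, as an induction on k: the slack D (k + 3) − ∑log is carried
-- along (on the left, with ∑log moved to the right).
mertens-abel : ∀ {s} → OnlyPrimes s → ∀ D k →
  suc k * ∑₂ (suc (suc k)) (inv D s) + D * (suc (suc k) + 2) ≤
    ∑log (suc (suc k)) (inv D s) + suc k * (7 * D + harmonic D (suc k))
  × ∑₂ (suc (suc k)) (inv D s) ≤ 7 * D + harmonic D (suc k)
mertens-abel {s} os D k = inv₁ k , bound k (inv₁ k)
  where
  open ≤-Reasoning
  g = inv D s
  W : ℕ → ℕ
  W k = 7 * D + harmonic D k
  Inv : ℕ → Set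
  Inv k = suc k * ∑₂ (suc (suc k)) g + D * (suc (suc k) + 2) ≤ ∑log (suc (suc k)) g + suc k * W (suc k)
  bound : ∀ k → Inv k → ∑₂ (suc (suc k)) g ≤ W (suc k)
  bound k h = *-cancelˡ-≤ (suc k) (+-cancelʳ-≤ (D * (suc (suc k) + 2)) _ _
    (≤-trans h (≤-trans (+-monoˡ-≤ _ (mertens-log os D (suc (suc k))))
      (≤-reflexive (+-comm (D * (suc (suc k) + 2)) _)))))
  inv₁ : ∀ k → Inv k
  inv₁ zero = begin
    -- Origin of the 7: the indices 1, 2, 3 contribute at most D each, and the slack contributes 4
    -- D.
    1 * (0 + (0 + g 1) + (0 + g 2 + g 3)) + D * 4 ≤⟨ +-monoˡ-≤ (D * 4) (*-monoʳ-≤ 1 (+-mono-≤ (inv≤ D s 1) (+-mono-≤ (inv≤ D s 2) (inv≤ D s 3)))) ⟩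
    1 * (D + (D + D)) + D * 4  ≡⟨ arrange D ⟩
    7 * D                      ≤⟨ m≤m+n (7 * D) (harmonic D 1) ⟩
    W 1                        ≡⟨ *-identityˡ (W 1) ⟨
    1 * W 1                    ≤⟨ m≤n+m (1 * W 1) (∑log 2 g) ⟩
    ∑log 2 g + 1 * W 1         ∎
    where
    arrange : ∀ D → 1 * (D + (D + D)) + D * 4 ≡ 7 * D
    arrange = solve-∀
  inv₁ (suc k) = begin
    suc K * (S + b) + D * (suc (suc K) + 2) ≡⟨ arrange₁ K S b D ⟩
    K * S + D * (suc K + 2) + S + suc K * b + D ≤⟨ +-mono-≤ (+-monoˡ-≤ (suc K * b) (+-mono-≤ (inv₁ k) (bound k (inv₁ k)))) (m≤n*[1+m/n] D (suc K)) ⟩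
    L + K * W K + W K + suc K * b + suc K * suc (D / suc K) ≡⟨ arrange₂ L K (7 * D) (harmonic D K) b (suc (D / suc K)) ⟩
    L + suc K * b + suc K * (7 * D + (harmonic D K + suc (D / suc K))) ∎
    where
    K = suc k
    S = ∑₂ (suc K) g
    L = ∑log (suc K) g
    b = ∑ (2 ^ suc K) (λ i → g (2 ^ suc K + i))
    arrange₁ : ∀ K S b D → (1 + K) * (S + b) + D * (2 + K + 2) ≡ K * S + D * (1 + K + 2) + S + (1 + K) * b + D
    arrange₁ = solve-∀
    arrange₂ : ∀ L K A H b h → L + K * (A + H) + (A + H) + (1 + K) * b + (1 + K) * h ≡ L + (1 + K) * b + (1 + K) * (A + (H + h))
    arrange₂ = solve-∀

mertens : ∀ {s} → OnlyPrimes s → ∀ D k → ∑₂ (suc (suc k)) (inv D s) ≤ 7 * D + harmonic D (suc k)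
mertens os D k = proj₂ (mertens-abel os D k)

-- Exponentials

bernoulli : ∀ D y → (D + y) * D ^ y ≤ D * suc D ^ y
bernoulli D zero    = ≤-reflexive (cong (_* 1) (+-identityʳ D))
bernoulli D (suc y) = begin
  (D + suc y) * (D * D ^ y)              ≤⟨ m≤m+n _ (y * D ^ y) ⟩
  (D + suc y) * (D * D ^ y) + y * D ^ y  ≡⟨ arrange D y (D ^ y) ⟩
  suc D * ((D + y) * D ^ y)              ≤⟨ *-monoʳ-≤ (suc D) (bernoulli D y) ⟩
  suc D * (D * suc D ^ y)                ≡⟨ arrange′ (suc D) D (suc D ^ y) ⟩
  D * (suc D * suc D ^ y)                ∎
  where
  open ≤-Reasoning
  arrange : ∀ D y x → (D + (1 + y)) * (D * x) + y * x ≡ (1 + D) * ((D + y) * x)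
  arrange = solve-∀
  arrange′ : ∀ a b c → a * (b * c) ≡ b * (a * c)
  arrange′ = solve-∀

-- The companion upper bound (1 + 1/D)^h ≤ 1/(1 - h/D), with r = D - h and denominators cleared.
bernoulli′ : ∀ D h r → h + r ≡ D → suc D ^ h * r ≤ D ^ h * D
bernoulli′ D zero    r refl = ≤-refl
bernoulli′ D (suc h) r eq   = begin
  suc D * suc D ^ h * r        ≡⟨ arrange D (suc D ^ h) r ⟩
  suc D ^ h * (D * r + r)      ≤⟨ *-monoʳ-≤ (suc D ^ h) (+-monoʳ-≤ (D * r) (subst (r ≤_) eq (m≤n+m r (suc h)))) ⟩
  suc D ^ h * (D * r + D)      ≡⟨ arrange′ D (suc D ^ h) r ⟩
  D * (suc D ^ h * suc r)      ≤⟨ *-monoʳ-≤ D (bernoulli′ D h (suc r) (trans (+-suc h r) eq)) ⟩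
  D * (D ^ h * D)              ≡⟨ *-assoc D (D ^ h) D ⟨
  D * D ^ h * D                ∎
  where
  open ≤-Reasoning
  arrange : ∀ D x r → (1 + D) * x * r ≡ x * (D * r + r)
  arrange = solve-∀
  arrange′ : ∀ D x r → x * (D * r + D) ≡ D * (x * (1 + r))
  arrange′ = solve-∀

-- With j = `suc k`, the hypothesis gives 1 - h/D ≥ (j - 1)/j. For h near D/j this is 1/j ≤ log
-- (j/(j - 1)), which lets harmonic sums telescope.
1+1/D^h≤j/[j-1] : ∀ D .{{_ : NonZero D}} h k → h * suc k ≤ D → suc D ^ h * k ≤ suc k * D ^ h
1+1/D^h≤j/[j-1] D h k hj≤D = *-cancelʳ-≤ _ _ D (begin
  suc D ^ h * k * D         ≡⟨ *-assoc (suc D ^ h) k D ⟩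
  suc D ^ h * (k * D)       ≤⟨ *-monoʳ-≤ (suc D ^ h) kD≤ ⟩
  suc D ^ h * (suc k * r)   ≡⟨ arrange (suc D ^ h) (suc k) r ⟩
  suc k * (suc D ^ h * r)   ≤⟨ *-monoʳ-≤ (suc k) (bernoulli′ D h r h+r≡D) ⟩
  suc k * (D ^ h * D)       ≡⟨ *-assoc (suc k) (D ^ h) D ⟨
  suc k * D ^ h * D         ∎)
  where
  open ≤-Reasoning
  r = D ∸ h
  h+r≡D : h + r ≡ D
  h+r≡D = m+[n∸m]≡n (≤-trans (m≤m*n h (suc k)) hj≤D)
  kD≤ : k * D ≤ suc k * r
  kD≤ = +-cancelˡ-≤ D _ _ (begin
    suc k * D               ≡⟨ cong (suc k *_) h+r≡D ⟨
    suc k * (h + r)         ≡⟨ arrange′ k h r ⟩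
    h * suc k + suc k * r   ≤⟨ +-monoˡ-≤ (suc k * r) hj≤D ⟩
    D + suc k * r           ∎)
    where
    arrange′ : ∀ k h r → (1 + k) * (h + r) ≡ h * (1 + k) + (1 + k) * r
    arrange′ = solve-∀
  arrange : ∀ a b c → a * (b * c) ≡ b * (a * c)
  arrange = solve-∀

-- x ⊑ c stands for (1 + 1/D)ˣ ≤ c; as 1 + 1/D is close to exp (1/D), this
-- plays the role of x/D ≤ log c.
module Exponent (D : ℕ) .{{D≢0 : NonZero D}} where

  infix 4 _⊑_
  _⊑_ : ℕ → ℕ → Set
  x ⊑ c = suc D ^ x ≤ c * D ^ x

  ⊑-+ : ∀ {x y a b} → x ⊑ a → y ⊑ b → x + y ⊑ a * b
  ⊑-+ {x} {y} {a} {b} p q = begin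
    suc D ^ (x + y)             ≡⟨ ^-distribˡ-+-* (suc D) x y ⟩
    suc D ^ x * suc D ^ y       ≤⟨ *-mono-≤ p q ⟩
    a * D ^ x * (b * D ^ y)     ≡⟨ arrange a b (D ^ x) (D ^ y) ⟩
    a * b * (D ^ x * D ^ y)     ≡⟨ cong (a * b *_) (^-distribˡ-+-* D x y) ⟨
    a * b * D ^ (x + y)         ∎
    where
    open ≤-Reasoning
    arrange : ∀ a b x y → a * x * (b * y) ≡ a * b * (x * y)
    arrange = solve-∀

  ⊑-monoʳ : ∀ {x a b} → a ≤ b → x ⊑ a → x ⊑ b
  ⊑-monoʳ {x} a≤b p = ≤-trans p (*-monoˡ-≤ (D ^ x) a≤b)

  ⊑-monoˡ : ∀ {x y c} → x ≤ y → y ⊑ c → x ⊑ c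
  ⊑-monoˡ {x} {y} {c} x≤y p = *-cancelʳ-≤ _ _ (D ^ z) {{m^n≢0 D z}} (begin
    suc D ^ x * D ^ z         ≤⟨ *-monoʳ-≤ (suc D ^ x) (^-monoˡ-≤ z (n≤1+n D)) ⟩
    suc D ^ x * suc D ^ z     ≡⟨ ^-distribˡ-+-* (suc D) x z ⟨
    suc D ^ (x + z)           ≡⟨ cong (suc D ^_) (m+[n∸m]≡n x≤y) ⟩
    suc D ^ y                 ≤⟨ p ⟩
    c * D ^ y                 ≡⟨ cong (λ w → c * D ^ w) (m+[n∸m]≡n x≤y) ⟨
    c * D ^ (x + z)           ≡⟨ cong (c *_) (^-distribˡ-+-* D x z) ⟩
    c * (D ^ x * D ^ z)       ≡⟨ *-assoc c (D ^ x) (D ^ z) ⟨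
    c * D ^ x * D ^ z         ∎)
    where
    open ≤-Reasoning
    z = y ∸ x

  ⊑-* : ∀ d {x c} → x ⊑ c → x * d ⊑ c ^ d
  ⊑-* d {x} {c} p = begin
    suc D ^ (x * d)       ≡⟨ ^-*-assoc (suc D) x d ⟨
    (suc D ^ x) ^ d       ≤⟨ ^-monoˡ-≤ d p ⟩
    (c * D ^ x) ^ d       ≡⟨ ^-distribʳ-* d c (D ^ x) ⟩
    c ^ d * (D ^ x) ^ d   ≡⟨ cong (c ^ d *_) (^-*-assoc D x d) ⟩
    c ^ d * D ^ (x * d)   ∎
    where open ≤-Reasoning

-- The case j = 2, in effect e^(1/2) ≤ 2. Its square, e ≤ 4, explains the base 4 of the exponentials
-- that follow.
half⊑2 : ∀ H .{{_ : NonZero (H + H)}} → Exponent._⊑_ (H + H) H 2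
half⊑2 H = subst (_≤ 2 * (H + H) ^ H) (*-identityʳ _)
  (1+1/D^h≤j/[j-1] (H + H) H 1 (≤-reflexive (trans (*-comm H 2) (cong (H +_) (+-identityʳ H)))))

double⊑4 : ∀ H .{{_ : NonZero (H + H)}} → Exponent._⊑_ (H + H) (H + H) 4
double⊑4 H = Exponent.⊑-+ (H + H) {H} {H} {2} {2} (half⊑2 H) (half⊑2 H)

module _ (D : ℕ) .{{D≢0 : NonZero D}} (D⊑4 : Exponent._⊑_ D D 4) where

  open Exponent D

  -- In effect H_k ≤ 1 + log k: the ratios j/(j - 1) telescope, and the first term, D itself, gives
  -- the factor 4.
  ∑D/j⊑ : ∀ k → ∑ (suc k) (λ i → D / suc i) ⊑ 4 * suc k
  ∑D/j⊑ zero    = subst (_⊑ 4) (sym (n/1≡n D)) D⊑4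
  ∑D/j⊑ (suc k) = *-cancelʳ-≤ _ _ K (begin
    suc D ^ (X + h) * K                    ≡⟨ cong (_* K) (^-distribˡ-+-* (suc D) X h) ⟩
    suc D ^ X * suc D ^ h * K              ≡⟨ *-assoc (suc D ^ X) _ _ ⟩
    suc D ^ X * (suc D ^ h * K)            ≤⟨ *-mono-≤ (∑D/j⊑ k) (1+1/D^h≤j/[j-1] D h K (m/n*n≤m D (suc K))) ⟩
    4 * K * D ^ X * (suc K * D ^ h)        ≡⟨ arrange K (D ^ X) (D ^ h) ⟩
    4 * suc K * (D ^ X * D ^ h) * K        ≡⟨ cong (λ w → 4 * suc K * w * K) (^-distribˡ-+-* D X h) ⟨
    4 * suc K * D ^ (X + h) * K            ∎)
    where
    open ≤-Reasoning
    K = suc k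
    X = ∑ K (λ i → D / suc i)
    h = D / suc K
    arrange : ∀ K x y → 4 * K * x * ((1 + K) * y) ≡ 4 * (1 + K) * (x * y) * K
    arrange = solve-∀

  -- The roundings add `suc k` ≤ D in all, which costs one more factor 4.
  harmonic⊑ : ∀ k → suc k ≤ D → harmonic D (suc k) ⊑ 4 * (4 * suc k)
  harmonic⊑ k k<D = subst (_⊑ 4 * (4 * suc k)) (sym (trans (∑-distrib-+ (suc k) (λ _ → 1) (λ i → D / suc i))
      (cong (_+ ∑ (suc k) (λ i → D / suc i)) (trans (∑-const (suc k) 1) (*-identityʳ (suc k))))))
    (⊑-+ {suc k} {∑ (suc k) (λ i → D / suc i)} {4} {4 * suc k} (⊑-monoˡ {suc k} {D} {4} k<D D⊑4) (∑D/j⊑ k))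

  c*D⊑4^c : ∀ c → c * D ⊑ 4 ^ c
  c*D⊑4^c c = subst (_⊑ 4 ^ c) (*-comm D c) (⊑-* c {D} {4} D⊑4)

-- p / (p − d) ≤ (1 + 1/(p − d))ᵈ ≤ (1 + 1/D)^(y d), where p = r + d.
factor-bound : ∀ D .{{_ : NonZero D}} d r .{{_ : NonZero r}} y → D ≤ y * r →
               (r + d) * D ^ (y * d) ≤ r * suc D ^ (y * d)
factor-bound D d r y D≤yr = *-cancelʳ-≤ _ _ (r ^ d) {{m^n≢0 r d}} (begin
  (r + d) * D ^ (y * d) * r ^ d          ≡⟨ arrange (r + d) (D ^ (y * d)) (r ^ d) ⟩
  (r + d) * r ^ d * D ^ (y * d)          ≤⟨ *-monoˡ-≤ (D ^ (y * d)) (bernoulli r d) ⟩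
  r * suc r ^ d * D ^ (y * d)            ≡⟨ cong (r * suc r ^ d *_) (^-*-assoc D y d) ⟨
  r * suc r ^ d * (D ^ y) ^ d            ≡⟨ *-assoc r _ _ ⟩
  r * (suc r ^ d * (D ^ y) ^ d)          ≡⟨ cong (r *_) (^-distribʳ-* d (suc r) (D ^ y)) ⟨
  r * (suc r * D ^ y) ^ d                ≤⟨ *-monoʳ-≤ r (^-monoˡ-≤ d step) ⟩
  r * (r * suc D ^ y) ^ d                ≡⟨ cong (r *_) (^-distribʳ-* d r (suc D ^ y)) ⟩
  r * (r ^ d * (suc D ^ y) ^ d)          ≡⟨ cong (λ w → r * (r ^ d * w)) (^-*-assoc (suc D) y d) ⟩
  r * (r ^ d * suc D ^ (y * d))          ≡⟨ arrange′ r (r ^ d) (suc D ^ (y * d)) ⟩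
  r * suc D ^ (y * d) * r ^ d            ∎)
  where
  open ≤-Reasoning
  arrange : ∀ a b c → a * b * c ≡ a * c * b
  arrange = solve-∀
  arrange′ : ∀ a b c → a * (b * c) ≡ a * c * b
  arrange′ = solve-∀
  step : suc r * D ^ y ≤ r * suc D ^ y
  step = *-cancelʳ-≤ _ _ D (begin
    suc r * D ^ y * D                ≡⟨ eq₁ r (D ^ y) D ⟩
    (r * D + D) * D ^ y              ≤⟨ *-monoˡ-≤ (D ^ y) (+-monoʳ-≤ (r * D) D≤yr) ⟩
    (r * D + y * r) * D ^ y          ≡⟨ eq₂ r (D ^ y) D y ⟩
    r * ((D + y) * D ^ y)            ≤⟨ *-monoʳ-≤ r (bernoulli D y) ⟩
    r * (D * suc D ^ y)              ≡⟨ arrange′ r D (suc D ^ y) ⟩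
    r * suc D ^ y * D                ∎)
    where
    eq₁ : ∀ r x D → (1 + r) * x * D ≡ (r * D + D) * x
    eq₁ = solve-∀
    eq₂ : ∀ r x D y → (r * D + y * r) * x ≡ r * ((D + y) * x)
    eq₂ = solve-∀

telescope : ∀ A n → ∑ n (λ j → A / (suc j * suc (suc j))) ≤ A
telescope A n = *-cancelˡ-≤ (suc n) (≤-trans (inv-n n) (*-monoˡ-≤ A (n≤1+n n)))
  where
  open ≤-Reasoning
  F : ℕ → ℕ
  F j = A / (suc j * suc (suc j))
  -- The partial sums of 1/((j + 1)(j + 2)) are n/(n + 1); this sharper value is what the induction
  -- carries.
  inv-n : ∀ n → suc n * ∑ n F ≤ n * A
  inv-n zero    = ≤-refl
  inv-n (suc n) = *-cancelˡ-≤ (suc n) (begin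
    suc n * (suc (suc n) * (∑ n F + F n))                   ≡⟨ eq₁ n (∑ n F) (F n) ⟩
    suc (suc n) * (suc n * ∑ n F) + F n * (suc n * suc (suc n)) ≤⟨ +-mono-≤ (*-monoʳ-≤ (suc (suc n)) (inv-n n)) (m/n*n≤m A (suc n * suc (suc n))) ⟩
    suc (suc n) * (n * A) + A                                ≡⟨ eq₂ n A ⟩
    suc n * (suc n * A)                                      ∎)
    where
    eq₁ : ∀ n s f → (1 + n) * ((2 + n) * (s + f)) ≡ (2 + n) * ((1 + n) * s) + f * ((1 + n) * (2 + n))
    eq₁ = solve-∀
    eq₂ : ∀ n A → (2 + n) * (n * A) + A ≡ (1 + n) * ((1 + n) * A)
    eq₂ = solve-∀

-- Mertens' theorem: the product of 1 − d/p

-- 1/(p - d) = 1/p + d/((p - d) p) with p = `suc r + d`. Lowering the last p to r + 2 makes the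
-- errors telescope; the 2 pays for rounding D/p up, by p ≤ D.
quotient-shift : ∀ D d r .{{_ : NonZero d}} → suc r + d ≤ D →
  D / suc r ≤ D / (suc r + d) + 1 + (2 * d * D) / (suc r * suc (suc r))
quotient-shift D d r p≤D = begin
  D / suc r                                  ≤⟨ /-monoˡ-≤ (suc r) D≤ ⟩
  (suc g * suc r + d * suc g) / suc r        ≡⟨ +-distrib-/-∣ˡ (d * suc g) {suc r} (n∣m*n (suc g)) ⟩
  suc g * suc r / suc r + d * suc g / suc r  ≡⟨ cong₂ _+_ (m*n/n≡m (suc g) (suc r)) (sym (m*n/o*n≡m/o (d * suc g) (suc (suc r)) (suc r))) ⟩
  suc g + d * suc g * suc (suc r) / (suc r * suc (suc r)) ≤⟨ +-mono-≤ (≤-reflexive (+-comm 1 g)) (/-monoˡ-≤ (suc r * suc (suc r)) bound) ⟩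
  g + 1 + (2 * d * D) / (suc r * suc (suc r)) ∎
  where
  open ≤-Reasoning
  p = suc r + d
  g = D / p
  D≤ : D ≤ suc g * suc r + d * suc g
  D≤ = ≤-trans (m≤n*[1+m/n] D (suc (r + d))) (≤-reflexive (arrange r d g))
    where
    arrange : ∀ r d g → (1 + (r + d)) * (1 + g) ≡ (1 + g) * (1 + r) + d * (1 + g)
    arrange = solve-∀
  r+2≤p : suc (suc r) ≤ p
  r+2≤p = s≤s (subst (_≤ r + d) (+-comm r 1) (+-monoʳ-≤ r (>-nonZero⁻¹ d)))
  bound : d * suc g * suc (suc r) ≤ 2 * d * D
  bound = begin
    d * suc g * suc (suc r)   ≤⟨ *-monoʳ-≤ (d * suc g) r+2≤p ⟩
    d * suc g * p             ≡⟨ eq₁ d g p ⟩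
    d * (p + g * p)           ≤⟨ *-monoʳ-≤ d (+-mono-≤ p≤D (m/n*n≤m D p)) ⟩
    d * (D + D)               ≡⟨ eq₂ d D ⟩
    2 * d * D                 ∎
    where
    eq₁ : ∀ d g p → d * (1 + g) * p ≡ d * (p + g * p)
    eq₁ = solve-∀
    eq₂ : ∀ d D → d * (D + D) ≡ 2 * d * D
    eq₂ = solve-∀

module _ {s : ℕ → Bool} (os : OnlyPrimes s) (d : ℕ) .{{d≢0 : NonZero d}} (d≤ : ∀ i → s i ≡ true → d ≤ i) where

  -- The product of p - d over the selected primes p = `suc i`; by d ≤ i the truncated subtraction
  -- is exact.
  shiftedProd : ℕ → ℕ
  shiftedProd n = ∏ n (λ i → pick (s i) (suc (i ∸ d)))

  private
    -- An integer above D/(p - d), as required of the y in `factor-bound`.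
    y : ℕ → ℕ → ℕ
    y D i = if s i then suc (D / suc (i ∸ d)) else 0

    F : ℕ → ℕ → ℕ
    F D j = (2 * d * D) / (suc j * suc (suc j))

    e : ℕ → ℕ → ℕ
    e D i = if s i then F D (i ∸ d) else 0

    y≤ : ∀ D i → suc i ≤ D → y D i ≤ inv D s i + 2 + e D i
    y≤ D i i<D with s i | d≤ i
    ... | false | _   = z≤n
    ... | true  | d≤i = begin
      suc (D / suc (i ∸ d))                             ≤⟨ s≤s (quotient-shift D d (i ∸ d) (subst (_≤ D) (sym p≡) i<D)) ⟩
      suc (D / (suc (i ∸ d) + d) + 1 + F D (i ∸ d))     ≡⟨ cong (λ p → suc (D / suc p + 1 + F D (i ∸ d))) (m∸n+n≡m (d≤i refl)) ⟩
      suc (D / suc i + 1 + F D (i ∸ d))                 ≡⟨ cong (_+ F D (i ∸ d)) (sym (+-suc (D / suc i) 1)) ⟩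
      D / suc i + 2 + F D (i ∸ d)                       ∎
      where
      open ≤-Reasoning
      p≡ : suc (i ∸ d) + d ≡ suc i
      p≡ = cong suc (m∸n+n≡m (d≤i refl))

    ∑e≤ : ∀ D n → ∑ n (e D) ≤ 2 * d * D
    ∑e≤ D n = begin
      ∑ n (e D)                                 ≤⟨ ∑-monoˡ (e D) (m≤n+m n d) ⟩
      ∑ (d + n) (e D)                           ≡⟨ ∑-split d n (e D) ⟩
      ∑ d (e D) + ∑ n (λ j → e D (d + j))       ≡⟨ cong (_+ ∑ n (λ j → e D (d + j))) (∑-zero d small) ⟩
      ∑ n (λ j → e D (d + j))                   ≤⟨ ∑-mono n (λ j _ → large j) ⟩
      ∑ n (F D)                                 ≤⟨ telescope (2 * d * D) n ⟩
      2 * d * D                                 ∎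
      where
      open ≤-Reasoning
      small : ∀ i → i < d → e D i ≡ 0
      small i i<d with s i | d≤ i
      ... | false | _   = refl
      ... | true  | d≤i = contradiction (d≤i refl) (<⇒≱ i<d)
      large : ∀ j → e D (d + j) ≤ F D j
      large j with s (d + j)
      ... | false = z≤n
      ... | true  = ≤-reflexive (cong (F D) (m+n∸m≡n d j))

    product≤ : ∀ D .{{_ : NonZero D}} n →
      ∏ n (λ i → pick (s i) (suc i)) * D ^ (∑ n (y D) * d) ≤ shiftedProd n * suc D ^ (∑ n (y D) * d)
    product≤ D zero    = ≤-refl
    product≤ D (suc n) = begin
      P * pick (s n) (suc n) * D ^ ((Y + y D n) * d)                  ≡⟨ cong (P * pick (s n) (suc n) *_) (pow D) ⟩
      P * pick (s n) (suc n) * (D ^ (Y * d) * D ^ (y D n * d))        ≡⟨ [m*n]*[o*p]≡[m*o]*[n*p] P _ _ _ ⟩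
      P * D ^ (Y * d) * (pick (s n) (suc n) * D ^ (y D n * d))        ≤⟨ *-mono-≤ (product≤ D n) factor ⟩
      R * suc D ^ (Y * d) * (pick (s n) (suc (n ∸ d)) * suc D ^ (y D n * d)) ≡⟨ [m*n]*[o*p]≡[m*o]*[n*p] R _ _ _ ⟩
      R * pick (s n) (suc (n ∸ d)) * (suc D ^ (Y * d) * suc D ^ (y D n * d)) ≡⟨ cong (R * pick (s n) (suc (n ∸ d)) *_) (pow (suc D)) ⟨
      R * pick (s n) (suc (n ∸ d)) * suc D ^ ((Y + y D n) * d)        ∎
      where
      open ≤-Reasoning
      P = ∏ n (λ i → pick (s i) (suc i))
      R = shiftedProd n
      Y = ∑ n (y D)
      pow : ∀ b → b ^ ((Y + y D n) * d) ≡ b ^ (Y * d) * b ^ (y D n * d)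
      pow b = trans (cong (b ^_) (*-distribʳ-+ d Y (y D n))) (^-distribˡ-+-* b (Y * d) _)
      factor : pick (s n) (suc n) * D ^ (y D n * d) ≤ pick (s n) (suc (n ∸ d)) * suc D ^ (y D n * d)
      factor with s n | d≤ n
      ... | false | _   = ≤-refl
      ... | true  | d≤n = subst (λ p → p * D ^ (w * d) ≤ suc (n ∸ d) * suc D ^ (w * d))
        (cong suc (m∸n+n≡m (d≤n refl)))
        (factor-bound D d (suc (n ∸ d)) w (m≤[1+m/n]*n D (suc (n ∸ d))))
        where w = suc (D / suc (n ∸ d))

  -- D is the sieving limit itself, so that bounded rounding errors at D indices add up to O(D), a
  -- constant factor after exponentiation. In 12 + 2 d, 7 comes from `mertens`, 1 from index 0, 2
  -- from roundings, 2 d from the telescoping errors and 2 from `harmonic⊑`.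
  mertens-product : ∀ k → primeProd s 0 (2 ^ suc (suc k)) ≤
                    shiftedProd (2 ^ suc (suc k)) * (4 ^ (12 + 2 * d) * suc (suc k)) ^ d
  mertens-product k = *-cancelʳ-≤ _ _ (D ^ (Y * d)) {{m^n≢0 D (Y * d)}} (begin
    primeProd s 0 D * D ^ (Y * d)                  ≤⟨ product≤ D D ⟩
    shiftedProd D * suc D ^ (Y * d)                ≤⟨ *-monoʳ-≤ (shiftedProd D) (⊑-* d {Y} {4 ^ (12 + 2 * d) * suc (suc k)} Y⊑) ⟩
    shiftedProd D * ((4 ^ (12 + 2 * d) * suc (suc k)) ^ d * D ^ (Y * d)) ≡⟨ *-assoc (shiftedProd D) _ _ ⟨
    shiftedProd D * (4 ^ (12 + 2 * d) * suc (suc k)) ^ d * D ^ (Y * d) ∎)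
    where
    open ≤-Reasoning
    H = 2 ^ suc k
    D = 2 ^ suc (suc k)
    Y = ∑ D (y D)
    instance
      D≢0 : NonZero D
      D≢0 = m^n≢0 2 (suc (suc k))
    open Exponent D
    D⊑4 : D ⊑ 4
    D⊑4 = subst (λ D → suc D ^ D ≤ 4 * D ^ D) (sym (2^[1+K] (suc k)))
      (double⊑4 H {{subst NonZero (2^[1+K] (suc k)) D≢0}})
    ∑inv≤ : ∑ D (inv D s) ≤ 8 * D + harmonic D (suc k)
    ∑inv≤ = begin
      ∑ D (inv D s)                         ≡⟨ ∑-dyadic (suc (suc k)) (inv D s) ⟩
      inv D s 0 + ∑₂ (suc (suc k)) (inv D s) ≤⟨ +-mono-≤ (inv≤ D s 0) (mertens os D k) ⟩
      D + (7 * D + harmonic D (suc k))      ≡⟨ +-assoc D (7 * D) _ ⟨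
      8 * D + harmonic D (suc k)            ∎
    Y≤ : Y ≤ (10 + 2 * d) * D + harmonic D (suc k)
    Y≤ = begin
      Y                                                   ≤⟨ ∑-mono D (λ i i<D → y≤ D i i<D) ⟩
      ∑ D (λ i → inv D s i + 2 + e D i)                   ≡⟨ ∑-distrib-+ D (λ i → inv D s i + 2) (e D) ⟩
      ∑ D (λ i → inv D s i + 2) + ∑ D (e D)               ≡⟨ cong (_+ ∑ D (e D)) (∑-distrib-+ D (inv D s) (λ _ → 2)) ⟩
      ∑ D (inv D s) + ∑ D (λ _ → 2) + ∑ D (e D)           ≤⟨ +-mono-≤ (+-mono-≤ ∑inv≤ (≤-reflexive (∑-const D 2))) (∑e≤ D D) ⟩
      8 * D + harmonic D (suc k) + D * 2 + 2 * d * D      ≡⟨ arrange D (harmonic D (suc k)) d ⟩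
      (10 + 2 * d) * D + harmonic D (suc k)               ∎
      where
      arrange : ∀ D h d → 8 * D + h + D * 2 + 2 * d * D ≡ (10 + 2 * d) * D + h
      arrange = solve-∀
    k<D : suc k ≤ D
    k<D = ≤-trans (n≤1+n (suc k)) (n≤2^n (suc (suc k)))
      where
      n≤2^n : ∀ n → n ≤ 2 ^ n
      n≤2^n zero    = z≤n
      n≤2^n (suc n) = subst (suc n ≤_) (sym (2^[1+K] n)) (+-mono-≤ (m^n>0 2 n) (n≤2^n n))
    Y⊑ : Y ⊑ 4 ^ (12 + 2 * d) * suc (suc k)
    Y⊑ = ⊑-monoˡ {Y} {(10 + 2 * d) * D + harmonic D (suc k)} {4 ^ (12 + 2 * d) * suc (suc k)} Y≤
      (⊑-monoʳ {(10 + 2 * d) * D + harmonic D (suc k)} const≤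
        (⊑-+ {(10 + 2 * d) * D} {harmonic D (suc k)} {4 ^ (10 + 2 * d)} {4 * (4 * suc k)}
          (c*D⊑4^c D D⊑4 (10 + 2 * d)) (harmonic⊑ D D⊑4 k k<D)))
      where
      const≤ : 4 ^ (10 + 2 * d) * (4 * (4 * suc k)) ≤ 4 ^ (12 + 2 * d) * suc (suc k)
      const≤ = begin
        4 ^ (10 + 2 * d) * (4 * (4 * suc k))   ≡⟨ arrange (4 ^ (10 + 2 * d)) (suc k) ⟩
        4 * (4 * 4 ^ (10 + 2 * d)) * suc k     ≤⟨ *-monoʳ-≤ (4 ^ (12 + 2 * d)) (n≤1+n (suc k)) ⟩
        4 ^ (12 + 2 * d) * suc (suc k)         ∎
        where
        arrange : ∀ x k → x * (4 * (4 * k)) ≡ 4 * (4 * x) * k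
        arrange = solve-∀

-- The sieve

-- As q does not divide β, two solutions j differ by a multiple of q, so each of the c blocks of
-- length q holds at most one.
∑-ap≤ : ∀ {q} → Prime q → ∀ α β → q ∤ β → ∀ {J} c → J ≤ c * q →
        ∑ J (λ j → 𝟙 (does (q ∣? (α + β * j)))) ≤ c
∑-ap≤ {q} pq α β q∤β {J} c J≤cq = begin
  ∑ J f                                 ≤⟨ ∑-monoˡ f J≤cq ⟩
  ∑ (c * q) f                           ≡⟨ ∑-blocks c q f ⟩
  ∑ c (λ b → ∑ q (λ i → f (b * q + i))) ≤⟨ ∑-mono c (λ b _ → ∑-≤1 q (λ i _ → 𝟙≤1 _) (unique b)) ⟩
  ∑ c (λ _ → 1)                         ≡⟨ ∑-const c 1 ⟩
  c * 1                                 ≡⟨ *-identityʳ c ⟩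
  c                                     ∎
  where
  open ≤-Reasoning
  f : ℕ → ℕ
  f j = 𝟙 (does (q ∣? (α + β * j)))
  f≥1⇒∣ : ∀ j → 1 ≤ f j → q ∣ α + β * j
  f≥1⇒∣ j h with q ∣? (α + β * j)
  ... | yes d = d
  f≥1⇒∣ j () | no _
  unique : ∀ b i j → i < j → j < q → 1 ≤ f (b * q + i) → 1 ≤ f (b * q + j) → ⊥
  unique b i j i<j j<q fi fj with euclidsLemma β (j ∸ i) pq
    (∣m+n∣m⇒∣n (subst (q ∣_) eq (f≥1⇒∣ (b * q + j) fj)) (f≥1⇒∣ (b * q + i) fi))
    where
    arrange : ∀ α β u i e → α + β * (u + (i + e)) ≡ α + β * (u + i) + β * e
    arrange = solve-∀
    eq : α + β * (b * q + j) ≡ α + β * (b * q + i) + β * (j ∸ i)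
    eq = trans (cong (λ k → α + β * (b * q + k)) (sym (m+[n∸m]≡n (<⇒≤ i<j)))) (arrange α β (b * q) i (j ∸ i))
  ... | inj₁ q∣β = q∤β q∣β
  ... | inj₂ q∣e = >⇒∤ {{>-nonZero (m<n⇒0<n∸m i<j)}} (≤-<-trans (m∸n≤m j i) j<q) q∣e

does-⇔ : ∀ {P Q : Set} (P? : Dec P) (Q? : Dec Q) → (P → Q) → (Q → P) → does P? ≡ does Q?
does-⇔ (yes p) (yes q) f g = refl
does-⇔ (yes p) (no ¬q) f g = contradiction (f p) ¬q
does-⇔ (no ¬p) (yes q) f g = contradiction (g q) ¬p
does-⇔ (no ¬p) (no ¬q) f g = refl

𝟙-∨ : ∀ a b → 𝟙 (a ∨ b) ≤ 𝟙 a + 𝟙 b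
𝟙-∨ true  b = s≤s z≤n
𝟙-∨ false b = ≤-refl

𝟙-∧ : ∀ a b → 𝟙 (a ∧ b) ≡ 𝟙 a * 𝟙 b
𝟙-∧ true  b = sym (+-identityʳ (𝟙 b))
𝟙-∧ false b = refl

𝟙-not : ∀ a → 𝟙 (not a) + 𝟙 a ≡ 1
𝟙-not true  = refl
𝟙-not false = refl

module Sieve (M : ℕ) (B : List ℕ) where

  hitBy : List ℕ → ℕ → ℕ → Bool
  hitBy []      q x = false
  hitBy (b ∷ B) q x = does (q ∣? (M * x + b)) ∨ hitBy B q x

  hit : ℕ → ℕ → Bool
  hit = hitBy B

  form-shift : ∀ j P x b → M * (j * P + x) + b ≡ M * x + b + M * P * j
  form-shift = expand M
    where
    expand : ∀ M j P x b → M * (j * P + x) + b ≡ M * x + b + M * P * j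
    expand = solve-∀

  hit-periodic : ∀ {q P} → q ∣ P → ∀ j x → hit q (j * P + x) ≡ hit q x
  hit-periodic {q} {P} q∣P j x = go B
    where
    q∣ : q ∣ M * P * j
    q∣ = ∣m⇒∣m*n j (∣n⇒∣m*n M q∣P)
    go : ∀ B → hitBy B q (j * P + x) ≡ hitBy B q x
    go []      = refl
    go (b ∷ B) = cong₂ _∨_
      (does-⇔ (q ∣? _) (q ∣? _)
        (λ d → ∣m+n∣m⇒∣n (subst (q ∣_) (trans (form-shift j P x b) (+-comm _ (M * P * j))) d) q∣)
        (λ d → subst (q ∣_) (sym (form-shift j P x b)) (∣m∣n⇒∣m+n d q∣)))
      (go B)

  -- Along the class of x modulo P each form is a progression in j with difference M P; a union
  -- bound over the forms gives the factor `length B`.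
  ∑-hit≤ : ∀ {q P} → Prime q → q ∤ M * P → ∀ x {J} c → J ≤ c * q →
           ∑ J (λ j → 𝟙 (hit q (j * P + x))) ≤ length B * c
  ∑-hit≤ {q} {P} pq q∤ x {J} c J≤cq = go B
    where
    open ≤-Reasoning
    go : ∀ B → ∑ J (λ j → 𝟙 (hitBy B q (j * P + x))) ≤ length B * c
    go []      = ≤-reflexive (∑-zero J λ _ _ → refl)
    go (b ∷ B) = begin
      ∑ J (λ j → 𝟙 (does (q ∣? (M * (j * P + x) + b)) ∨ hitBy B q (j * P + x)))
        ≤⟨ ∑-mono J (λ j _ → 𝟙-∨ (does (q ∣? (M * (j * P + x) + b))) _) ⟩
      ∑ J (λ j → 𝟙 (does (q ∣? (M * (j * P + x) + b))) + 𝟙 (hitBy B q (j * P + x)))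
        ≡⟨ ∑-distrib-+ J (λ j → 𝟙 (does (q ∣? (M * (j * P + x) + b)))) (λ j → 𝟙 (hitBy B q (j * P + x))) ⟩
      ∑ J (λ j → 𝟙 (does (q ∣? (M * (j * P + x) + b)))) + ∑ J (λ j → 𝟙 (hitBy B q (j * P + x)))
        ≤⟨ +-mono-≤ (≤-trans (≤-reflexive (∑-cong J λ j _ → cong (λ v → 𝟙 (does (q ∣? v))) (form-shift j P x b)))
                             (∑-ap≤ pq (M * x + b) (M * P) q∤ c J≤cq))
                    (go B) ⟩
      c + length B * c ∎

  missed : List ℕ → ℕ → Bool
  missed []      x = true
  missed (q ∷ L) x = not (hit q x) ∧ missed L x

  -- Union bound: each prime of L removes at most `length B * c` of the J members of the class.
  ∑-missed≥ : ∀ {P Z} L → All (λ q → Prime q × q ∤ M * P × Z ≤ q) L → ∀ x J c → J ≤ c * Z →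
              J ≤ ∑ J (λ j → 𝟙 (missed L (j * P + x))) + length L * (length B * c)
  ∑-missed≥ [] [] x J c J≤ = ≤-reflexive (sym (trans (+-identityʳ _) (trans (∑-const J 1) (*-identityʳ J))))
  ∑-missed≥ {P} {Z} (q ∷ L) ((pq , q∤ , Z≤q) ∷ h) x J c J≤ = begin
    J                                                   ≤⟨ ∑-missed≥ L h x J c J≤ ⟩
    ∑ J (λ j → 𝟙 (missed L (y j))) + l                  ≤⟨ +-monoˡ-≤ l (∑-mono J (λ j _ → split (hit q (y j)) (missed L (y j)))) ⟩
    ∑ J (λ j → 𝟙 (not (hit q (y j)) ∧ missed L (y j)) + 𝟙 (hit q (y j))) + l
      ≡⟨ cong (_+ l) (∑-distrib-+ J (λ j → 𝟙 (not (hit q (y j)) ∧ missed L (y j))) (λ j → 𝟙 (hit q (y j)))) ⟩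
    G + ∑ J (λ j → 𝟙 (hit q (y j))) + l                 ≤⟨ +-monoˡ-≤ l (+-monoʳ-≤ G (∑-hit≤ pq q∤ x c (≤-trans J≤ (*-monoʳ-≤ c Z≤q)))) ⟩
    G + length B * c + l                                ≡⟨ +-assoc G (length B * c) l ⟩
    G + (length B * c + l)                              ∎
    where
    open ≤-Reasoning
    y : ℕ → ℕ
    y j = j * P + x
    l = length L * (length B * c)
    G = ∑ J (λ j → 𝟙 (missed (q ∷ L) (y j)))
    split : ∀ a b → 𝟙 b ≤ 𝟙 (not a ∧ b) + 𝟙 a
    split true  true  = s≤s z≤n
    split true  false = z≤n
    split false b     = m≤m+n (𝟙 b) 0

  module _ {s : ℕ → Bool} (os : OnlyPrimes s) .{{d≢0 : NonZero (length B)}} (d≤ : ∀ i → s i ≡ true → length B ≤ i)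
           (∤M : ∀ i → s i ≡ true → suc i ∤ M) where

    private
      d = length B
      P : ℕ → ℕ
      P = primeProd s 0

    survives : ℕ → ℕ → Bool
    survives zero    x = true
    survives (suc k) x = survives k x ∧ (if s k then not (hit (suc k) x) else true)

    survives-periodic : ∀ {Q} k → (∀ i → i < k → s i ≡ true → suc i ∣ Q) → ∀ j x → survives k (j * Q + x) ≡ survives k x
    survives-periodic     zero    h j x = refl
    survives-periodic {Q} (suc k) h j x = cong₂ _∧_ (survives-periodic k (λ i i<k → h i (m<n⇒m<1+n i<k)) j x) last
      where
      last : (if s k then not (hit (suc k) (j * Q + x)) else true) ≡ (if s k then not (hit (suc k) x) else true)
      last with s k in eq
      ... | false = refl
      ... | true  = cong not (hit-periodic (h k (n<1+n k) eq) j x)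

    survives-period : ∀ k j x → survives k (j * P k + x) ≡ survives k x
    survives-period k = survives-periodic k λ i i<k si → ∣primeProd s 0 k i<k si

    next∤ : ∀ k → s k ≡ true → suc k ∤ M * P k
    next∤ k sk p∣ with euclidsLemma M (P k) (os k sk) p∣
    ... | inj₁ p∣M = ∤M k sk p∣M
    ... | inj₂ p∣P with prime∣primeProd os 0 k (os k sk) p∣P
    ...   | i , i<k , _ , eq = <⇒≢ i<k (sym (suc-injective eq))

    -- The Chinese remainder theorem by lifting: a survivor x modulo `P k` has p lifts
    -- `j * P k + x`. By periodicity all survive the earlier primes, and p hits at most d of them.
    ∑-survives≥ : ∀ k → shiftedProd os d d≤ k ≤ ∑ (P k) (λ x → 𝟙 (survives k x))
    ∑-survives≥ zero    = ≤-refl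
    ∑-survives≥ (suc k) with s k in sk
    ... | false = begin
      shiftedProd os d d≤ k * 1                       ≡⟨ *-identityʳ _ ⟩
      shiftedProd os d d≤ k                           ≤⟨ ∑-survives≥ k ⟩
      ∑ (P k) (λ x → 𝟙 (survives k x))                ≡⟨ ∑-cong (P k) (λ x _ → cong 𝟙 (sym (∧-identityʳ (survives k x)))) ⟩
      ∑ (P k) (λ x → 𝟙 (survives k x ∧ true))         ≡⟨ cong (λ n → ∑ n (λ x → 𝟙 (survives k x ∧ true))) (sym (*-identityʳ (P k))) ⟩
      ∑ (P k * 1) (λ x → 𝟙 (survives k x ∧ true))     ∎
      where
      open ≤-Reasoning
    ... | true  = begin
      shiftedProd os d d≤ k * suc (k ∸ d)             ≤⟨ *-monoˡ-≤ (suc (k ∸ d)) (∑-survives≥ k) ⟩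
      ∑ (P k) (λ x → 𝟙 (survives k x)) * suc (k ∸ d)  ≡⟨ *-comm _ (suc (k ∸ d)) ⟩
      suc (k ∸ d) * ∑ (P k) (λ x → 𝟙 (survives k x))  ≡⟨ ∑-distrib-* (P k) (suc (k ∸ d)) (λ x → 𝟙 (survives k x)) ⟨
      ∑ (P k) (λ x → suc (k ∸ d) * 𝟙 (survives k x))  ≤⟨ ∑-mono (P k) (λ x _ → lift x) ⟩
      ∑ (P k) (λ x → ∑ p (λ j → f (j * P k + x)))     ≡⟨ ∑-swap (P k) p (λ x j → f (j * P k + x)) ⟩
      ∑ p (λ j → ∑ (P k) (λ x → f (j * P k + x)))     ≡⟨ ∑-blocks p (P k) f ⟨
      ∑ (p * P k) f                                   ≡⟨ cong (λ n → ∑ n f) (*-comm p (P k)) ⟩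
      ∑ (P k * p) f                                   ∎
      where
      open ≤-Reasoning
      p = suc k
      f : ℕ → ℕ
      f x = 𝟙 (survives k x ∧ not (hit p x))
      unhit≥ : ∀ x → suc (k ∸ d) ≤ ∑ p (λ j → 𝟙 (not (hit p (j * P k + x))))
      unhit≥ x = +-cancelʳ-≤ d _ _ (begin
        suc (k ∸ d) + d                                       ≡⟨ cong suc (m∸n+n≡m (d≤ k sk)) ⟩
        p                                                     ≡⟨ *-identityʳ p ⟨
        p * 1                                                 ≡⟨ ∑-const p 1 ⟨
        ∑ p (λ _ → 1)                                         ≡⟨ ∑-cong p (λ j _ → sym (𝟙-not (hit p (j * P k + x)))) ⟩
        ∑ p (λ j → 𝟙 (not (hit p (j * P k + x))) + 𝟙 (hit p (j * P k + x)))
          ≡⟨ ∑-distrib-+ p (λ j → 𝟙 (not (hit p (j * P k + x)))) (λ j → 𝟙 (hit p (j * P k + x))) ⟩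
        U + ∑ p (λ j → 𝟙 (hit p (j * P k + x)))               ≤⟨ +-monoʳ-≤ U (∑-hit≤ (os k sk) (next∤ k sk) x 1 (≤-reflexive (sym (*-identityˡ p)))) ⟩
        U + d * 1                                             ≡⟨ cong (U +_) (*-identityʳ d) ⟩
        U + d                                                 ∎)
        where U = ∑ p (λ j → 𝟙 (not (hit p (j * P k + x))))
      lift : ∀ x → suc (k ∸ d) * 𝟙 (survives k x) ≤ ∑ p (λ j → f (j * P k + x))
      lift x = begin
        suc (k ∸ d) * 𝟙 (survives k x)                          ≤⟨ *-monoˡ-≤ (𝟙 (survives k x)) (unhit≥ x) ⟩
        ∑ p (λ j → 𝟙 (not (hit p (j * P k + x)))) * 𝟙 (survives k x) ≡⟨ *-comm _ (𝟙 (survives k x)) ⟩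
        𝟙 (survives k x) * ∑ p (λ j → 𝟙 (not (hit p (j * P k + x)))) ≡⟨ ∑-distrib-* p (𝟙 (survives k x)) (λ j → 𝟙 (not (hit p (j * P k + x)))) ⟨
        ∑ p (λ j → 𝟙 (survives k x) * 𝟙 (not (hit p (j * P k + x)))) ≡⟨ ∑-cong p (λ j _ → cong (λ b → 𝟙 b * 𝟙 (not (hit p (j * P k + x)))) (sym (survives-period k j x))) ⟩
        ∑ p (λ j → 𝟙 (survives k (j * P k + x)) * 𝟙 (not (hit p (j * P k + x)))) ≡⟨ ∑-cong p (λ j _ → sym (𝟙-∧ (survives k (j * P k + x)) _)) ⟩
        ∑ p (λ j → f (j * P k + x)) ∎

    -- J periods contain J members of each surviving class, and the last hypothesis says that the
    -- primes of L remove at most half of them; hence the 2.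
    sieve : ∀ k {Z} L → All (λ q → Prime q × q ∤ M * P k × Z ≤ q) L → ∀ X J c →
            J * P k ≤ X → J ≤ c * Z → 2 * (length L * (d * c)) ≤ J →
            shiftedProd os d d≤ k * J ≤ 2 * ∑ X (λ x → 𝟙 (survives k x ∧ missed L x))
    sieve k {Z} L hL X J c JP≤X J≤cZ few = begin
      shiftedProd os d d≤ k * J                           ≤⟨ *-monoˡ-≤ J (∑-survives≥ k) ⟩
      ∑ (P k) (λ x → 𝟙 (survives k x)) * J                ≡⟨ *-comm _ J ⟩
      J * ∑ (P k) (λ x → 𝟙 (survives k x))                ≡⟨ ∑-distrib-* (P k) J (λ x → 𝟙 (survives k x)) ⟨
      ∑ (P k) (λ x → J * 𝟙 (survives k x))                ≤⟨ ∑-mono (P k) (λ x _ → lift x) ⟩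
      ∑ (P k) (λ x → 2 * ∑ J (λ j → f (j * P k + x)))     ≡⟨ ∑-distrib-* (P k) 2 (λ x → ∑ J (λ j → f (j * P k + x))) ⟩
      2 * ∑ (P k) (λ x → ∑ J (λ j → f (j * P k + x)))     ≡⟨ cong (2 *_) (∑-swap (P k) J (λ x j → f (j * P k + x))) ⟩
      2 * ∑ J (λ j → ∑ (P k) (λ x → f (j * P k + x)))     ≡⟨ cong (2 *_) (∑-blocks J (P k) f) ⟨
      2 * ∑ (J * P k) f                                   ≤⟨ *-monoʳ-≤ 2 (∑-monoˡ f JP≤X) ⟩
      2 * ∑ X f                                           ∎
      where
      open ≤-Reasoning
      f : ℕ → ℕ
      f x = 𝟙 (survives k x ∧ missed L x)
      J≤2∑ : ∀ x → J ≤ 2 * ∑ J (λ j → 𝟙 (missed L (j * P k + x)))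
      J≤2∑ x = +-cancelʳ-≤ J _ _ (begin
        J + J                                  ≤⟨ +-mono-≤ h h ⟩
        (U + l) + (U + l)                      ≡⟨ arrange U l ⟩
        2 * U + 2 * l                          ≤⟨ +-monoʳ-≤ (2 * U) few ⟩
        2 * U + J                              ∎)
        where
        U = ∑ J (λ j → 𝟙 (missed L (j * P k + x)))
        l = length L * (d * c)
        h : J ≤ U + l
        h = ∑-missed≥ L hL x J c J≤cZ
        arrange : ∀ U l → (U + l) + (U + l) ≡ 2 * U + 2 * l
        arrange = solve-∀
      lift : ∀ x → J * 𝟙 (survives k x) ≤ 2 * ∑ J (λ j → f (j * P k + x))
      lift x = begin
        J * 𝟙 (survives k x)                                     ≤⟨ *-monoˡ-≤ (𝟙 (survives k x)) (J≤2∑ x) ⟩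
        2 * ∑ J (λ j → 𝟙 (missed L (j * P k + x))) * 𝟙 (survives k x) ≡⟨ arrange (∑ J (λ j → 𝟙 (missed L (j * P k + x)))) (𝟙 (survives k x)) ⟩
        2 * (𝟙 (survives k x) * ∑ J (λ j → 𝟙 (missed L (j * P k + x)))) ≡⟨ cong (2 *_) (∑-distrib-* J (𝟙 (survives k x)) (λ j → 𝟙 (missed L (j * P k + x)))) ⟨
        2 * ∑ J (λ j → 𝟙 (survives k x) * 𝟙 (missed L (j * P k + x))) ≡⟨ cong (2 *_) (∑-cong J (λ j _ → trans (cong (λ b → 𝟙 b * 𝟙 (missed L (j * P k + x))) (sym (survives-period k j x))) (sym (𝟙-∧ (survives k (j * P k + x)) _)))) ⟩
        2 * ∑ J (λ j → f (j * P k + x)) ∎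
        where
        arrange : ∀ a b → 2 * a * b ≡ 2 * (b * a)
        arrange = solve-∀

-- Integers coprime to m

noCommonPrime⇒coprime : ∀ {v m} → .{{NonZero m}} → (∀ {p} → Prime p → p ∣ m → p ∤ v) → Coprime v m
noCommonPrime⇒coprime {v} {m} h {zero}  (_ , 0∣m) = ⊥-elim (≢-nonZero⁻¹ m (0∣⇒≡0 0∣m))
noCommonPrime⇒coprime {v} {m} h {suc e} (e∣v , e∣m) with factorise (suc e)
... | record { factors = [] ; isFactorisation = eq } = eq
... | record { factors = q ∷ qs ; isFactorisation = eq ; factorsPrime = pq ∷ _ } =
  ⊥-elim (h pq (∣-trans q∣e e∣m) (∣-trans q∣e e∣v))
  where
  q∣e : q ∣ suc e
  q∣e = subst (q ∣_) (sym eq) (m∣m*n (product qs))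

-- Limits the number t of prime factors above Z, with multiplicity, by Z^t ≤ m.
^length-filter≤product : ∀ Z qs → All Prime qs → Z ^ length (filter (Z <?_) qs) ≤ product qs
^length-filter≤product Z [] [] = ≤-refl
^length-filter≤product Z (q ∷ qs) (pq ∷ pqs) with Z <? q
... | yes Z<q = subst (λ l → Z ^ length l ≤ q * product qs) (sym (filter-accept (Z <?_) Z<q))
                  (*-mono-≤ (<⇒≤ Z<q) (^length-filter≤product Z qs pqs))
... | no  Z≮q = subst (λ l → Z ^ length l ≤ q * product qs) (sym (filter-reject (Z <?_) Z≮q))
                  (≤-trans (^length-filter≤product Z qs pqs) (m≤n*m (product qs) q {{prime⇒nonZero pq}}))

n<4^n : ∀ n → n < 4 ^ n
n<4^n zero    = s≤s z≤n
n<4^n (suc n) = ≤-trans (+-mono-≤ (m^n>0 4 n) (n<4^n n)) (+-monoʳ-≤ (4 ^ n) (m≤m+n (4 ^ n) _))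

not-true : ∀ {b} → not b ≡ true → b ≡ false
not-true {false} _ = refl

-- The 8 is the 2 of the first bound on n, times 2 from `suc Y` ≤ 2 Y, times 2 from the sieve.
assemble : ∀ M Y R P C d a G {n} → 1 ≤ Y → n ≤ 2 * M * (suc Y * P) → P ≤ R * (C * (2 * a)) ^ d → R * Y ≤ 2 * G →
           n ≤ 8 * M * (C * 2) ^ d * (a ^ d * G)
assemble M Y R P C d a G {n} 1≤Y n≤ P≤ RY≤2G = begin
  n                                          ≤⟨ n≤ ⟩
  2 * M * (suc Y * P)                        ≤⟨ *-monoʳ-≤ (2 * M) (*-mono-≤ (+-monoˡ-≤ Y 1≤Y) P≤) ⟩
  2 * M * ((Y + Y) * (R * (C * (2 * a)) ^ d)) ≡⟨ cong (λ w → 2 * M * ((Y + Y) * (R * w))) pow ⟩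
  2 * M * ((Y + Y) * (R * ((C * 2) ^ d * a ^ d))) ≡⟨ arrange M Y R ((C * 2) ^ d) (a ^ d) ⟩
  4 * M * (C * 2) ^ d * (a ^ d * (R * Y))    ≤⟨ *-monoʳ-≤ (4 * M * (C * 2) ^ d) (*-monoʳ-≤ (a ^ d) RY≤2G) ⟩
  4 * M * (C * 2) ^ d * (a ^ d * (2 * G))    ≡⟨ arrange′ M ((C * 2) ^ d) (a ^ d) G ⟩
  8 * M * (C * 2) ^ d * (a ^ d * G)          ∎
  where
  open ≤-Reasoning
  pow : (C * (2 * a)) ^ d ≡ (C * 2) ^ d * a ^ d
  pow = trans (cong (_^ d) (sym (*-assoc C 2 a))) (^-distribʳ-* d (C * 2) a)
  arrange : ∀ M Y R c x → 2 * M * ((Y + Y) * (R * (c * x))) ≡ 4 * M * c * (x * (R * Y))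
  arrange = solve-∀
  arrange′ : ∀ M c x G → 4 * M * c * (x * (2 * G)) ≡ 8 * M * c * (x * G)
  arrange′ = solve-∀

-- The prime factors of M are at most d and those of m exceed d, so every prime relevant to m is
-- prime to M and exceeds the number of forms.
module Forms (M : ℕ) (B : List ℕ) .{{d≢0 : NonZero (length B)}}
             (M≤8 : M ≤ 8) (M-smooth : ∀ {p} → Prime p → length B < p → p ∤ M)
             {m : ℕ} .{{m≢0 : NonZero m}} (fac : PrimeFactorisation m) (m-rough : ∀ {p} → Prime p → p ∣ m → length B < p) where

  open Sieve M B

  private
    d = length B

  largePrime : ℕ → Bool
  largePrime i = does (prime? (suc i)) ∧ does (d ≤? i)

  largePrime-prime : OnlyPrimes largePrime
  largePrime-prime i e = does-true (prime? (suc i)) (proj₁ (∧-true e))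

  largePrime≥ : ∀ i → largePrime i ≡ true → d ≤ i
  largePrime≥ i e = does-true (d ≤? i) (proj₂ (∧-true {does (prime? (suc i))} e))

  largePrime∤M : ∀ i → largePrime i ≡ true → suc i ∤ M
  largePrime∤M i e = M-smooth (largePrime-prime i e) (s≤s (largePrime≥ i e))

  bigFactors : ℕ → List ℕ
  bigFactors Z = filter (Z <?_) (PrimeFactorisation.factors fac)

  -- Sufficient for coprimality to m but not necessary, as all primes in (d, Z] are avoided.
  good : ℕ → ℕ → Bool
  good Z x = survives largePrime-prime largePrime≥ largePrime∤M Z x ∧ missed (bigFactors Z) x

  private
    hit-false : ∀ {q x} → hit q x ≡ false → ∀ {b} → b ∈ B → q ∤ M * x + b
    hit-false {q} {x} = go B
      where
      go : ∀ B → hitBy B q x ≡ false → ∀ {b} → b ∈ B → q ∤ M * x + b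
      go (b ∷ B) e b∈ q∣ with q ∣? (M * x + b)
      go (b ∷ B) e  (here refl) q∣ | no ¬d = ¬d q∣
      go (b ∷ B) e  (there b∈)  q∣ | no _  = go B e b∈ q∣

    survives⇒ : ∀ k {x} → survives largePrime-prime largePrime≥ largePrime∤M k x ≡ true →
                ∀ i → i < k → largePrime i ≡ true → hit (suc i) x ≡ false
    survives⇒ (suc k) e i i<1+k li with ∧-true e
    ... | e₁ , e₂ with m<1+n⇒m<n∨m≡n i<1+k
    ...   | inj₁ i<k = survives⇒ k e₁ i i<k li
    ...   | inj₂ refl rewrite li = not-true e₂

    missed⇒ : ∀ L {x} → missed L x ≡ true → ∀ {q} → q ∈ L → hit q x ≡ false
    missed⇒ (q ∷ L) {x} e (here refl) = not-true (proj₁ (∧-true {not (hit q x)} e))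
    missed⇒ (q ∷ L) {x} e (there q∈)  = missed⇒ L (proj₂ (∧-true {not (hit q x)} e)) q∈

  good⇒coprime : ∀ Z {x} → good Z x ≡ true → ∀ {b} → b ∈ B → Coprime (M * x + b) m
  good⇒coprime Z {x} e {b} b∈ = noCommonPrime⇒coprime no-common
    where
    split : survives largePrime-prime largePrime≥ largePrime∤M Z x ≡ true × missed (bigFactors Z) x ≡ true
    split = ∧-true {survives largePrime-prime largePrime≥ largePrime∤M Z x} e
    unhit : ∀ {i} → Prime (suc i) → suc i ∣ m → Dec (Z < suc i) → hit (suc i) x ≡ false
    unhit {i} pp p∣m (yes Z<p) = missed⇒ (bigFactors Z) (proj₂ split) (∈-filter⁺ (Z <?_) p∈ Z<p)
      where
      p∈ : suc i ∈ PrimeFactorisation.factors fac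
      p∈ = factorisationHasAllPrimeFactors pp
        (subst (suc i ∣_) (PrimeFactorisation.isFactorisation fac) p∣m) (PrimeFactorisation.factorsPrime fac)
    unhit {i} pp p∣m (no Z≮p) = survives⇒ Z (proj₁ split) i (≮⇒≥ Z≮p)
      (cong₂ _∧_ (true-does (prime? (suc i)) pp) (true-does (d ≤? i) (s≤s⁻¹ (m-rough pp p∣m))))
    no-common : ∀ {p} → Prime p → p ∣ m → p ∤ M * x + b
    no-common {zero}  pp _   = ⊥-elim (≢-nonZero⁻¹ 0 {{prime⇒nonZero pp}} refl)
    no-common {suc i} pp p∣m = hit-false (unhit pp p∣m (Z <? suc i)) b∈

  -- `n-lower` is W^4 ≤ n for W = 4^Z: one W covers P, one covers 2 M, and W² remains for the number
  -- of periods. `n-upper` gives a t ≤ 16 Z for the number t of factors above Z, which `a-large`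
  -- turns into 4 t d ≤ Z.
  module Count (a′ : ℕ) {Z : ℕ} (Z≡4^a : Z ≡ 4 ^ suc a′) (a-large : 64 * d ≤ suc a′) {n : ℕ} (m≤n : m ≤ n)
               (n-lower : 4 ^ (4 * Z) ≤ n) (n-upper : n < 4 ^ (16 * Z))
               (X : ℕ) (n≤2MX : n ≤ 2 * M * X) where

    private
      open ≤-Reasoning
      a = suc a′
      K = 2 * a
      P = primeProd largePrime 0 Z
      W = 4 ^ Z
      L = bigFactors Z
      t = length L
      R = shiftedProd largePrime-prime d largePrime≥ Z

      Z≡2^K : Z ≡ 2 ^ K
      Z≡2^K = trans Z≡4^a (^-*-assoc 2 2 a)

      instance
        P≢0 : NonZero P
        P≢0 = >-nonZero (primeProd≥1 largePrime 0 Z)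
        W≢0 : NonZero W
        W≢0 = m^n≢0 4 Z
        Z≢0 : NonZero Z
        Z≢0 = subst NonZero (sym Z≡4^a) (m^n≢0 4 a)
      Y = X / P

      P≤W : P ≤ W
      P≤W = subst (λ z → primeProd largePrime 0 z ≤ 4 ^ z) (sym Z≡2^K) (primeProd≤4^ largePrime-prime K)

      n≤2M[1+Y]P : n ≤ 2 * M * (suc Y * P)
      n≤2M[1+Y]P = ≤-trans n≤2MX (*-monoʳ-≤ (2 * M) (m≤[1+m/n]*n X P))

      4≤Z : 4 ≤ Z
      4≤Z = subst (4 ≤_) (sym Z≡4^a) (^-monoʳ-≤ 4 {1} {a} (s≤s z≤n))

      2M≤W : 2 * M ≤ W
      2M≤W = ≤-trans (*-monoʳ-≤ 2 M≤8) (^-monoʳ-≤ 4 {2} {Z} (≤-trans (s≤s (s≤s z≤n)) 4≤Z))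

      Z≤Y : Z ≤ Y
      Z≤Y = s≤s⁻¹ (begin
        suc Z               ≤⟨ n<4^n Z ⟩
        W                   ≤⟨ m≤m*n W W ⟩
        W * W               ≤⟨ *-cancelˡ-≤ (W * W) {{m*n≢0 W W}} W⁴≤ ⟩
        suc Y               ∎)
        where
        W⁴≤ : W * W * (W * W) ≤ W * W * suc Y
        W⁴≤ = begin
          W * W * (W * W)       ≡⟨ arrange W ⟩
          W * (W * (W * (W * 1))) ≡⟨ ^-*-assoc 4 Z 4 ⟩
          4 ^ (Z * 4)           ≡⟨ cong (4 ^_) (*-comm Z 4) ⟩
          4 ^ (4 * Z)           ≤⟨ n-lower ⟩
          n                     ≤⟨ n≤2M[1+Y]P ⟩
          2 * M * (suc Y * P)   ≤⟨ *-mono-≤ 2M≤W (*-monoʳ-≤ (suc Y) P≤W) ⟩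
          W * (suc Y * W)       ≡⟨ arrange′ W (suc Y) ⟩
          W * W * suc Y         ∎
          where
          arrange : ∀ w → w * w * (w * w) ≡ w * (w * (w * (w * 1)))
          arrange = solve-∀
          arrange′ : ∀ w y → w * (y * w) ≡ w * w * y
          arrange′ = solve-∀

      a*t≤16Z : a * t ≤ 16 * Z
      a*t≤16Z = *-cancelˡ-≤ 2 (2^-cancel-≤ (begin
        2 ^ (2 * (a * t))      ≡⟨ cong (2 ^_) (*-assoc 2 a t) ⟨
        2 ^ (K * t)            ≡⟨ ^-*-assoc 2 K t ⟨
        (2 ^ K) ^ t            ≡⟨ cong (_^ t) Z≡2^K ⟨
        Z ^ t                  ≤⟨ ^length-filter≤product Z _ (PrimeFactorisation.factorsPrime fac) ⟩
        product (PrimeFactorisation.factors fac) ≡⟨ PrimeFactorisation.isFactorisation fac ⟨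
        m                      ≤⟨ m≤n ⟩
        n                      ≤⟨ <⇒≤ n-upper ⟩
        4 ^ (16 * Z)           ≡⟨ ^-*-assoc 2 2 (16 * Z) ⟩
        2 ^ (2 * (16 * Z))     ∎))

      4dt≤Z : 4 * (t * d) ≤ Z
      4dt≤Z = *-cancelˡ-≤ 16 (begin
        16 * (4 * (t * d))   ≡⟨ arrange t d ⟩
        64 * d * t           ≤⟨ *-monoˡ-≤ t a-large ⟩
        a * t                ≤⟨ a*t≤16Z ⟩
        16 * Z               ∎)
        where
        arrange : ∀ t d → 16 * (4 * (t * d)) ≡ 64 * d * t
        arrange = solve-∀

      -- Enough blocks of length Z to cover Y; Z ≤ Y keeps c Z at most 2 Y.
      c = suc (Y / Z)

      few : 2 * (t * (d * c)) ≤ Y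
      few = *-cancelˡ-≤ 2 (begin
        2 * (2 * (t * (d * c)))  ≡⟨ arrange t d c ⟩
        4 * (t * d) * c          ≤⟨ *-monoˡ-≤ c 4dt≤Z ⟩
        Z * c                    ≡⟨ arrange′ Z (Y / Z) ⟩
        Z + Y / Z * Z            ≤⟨ +-mono-≤ Z≤Y (m/n*n≤m Y Z) ⟩
        Y + Y                    ≡⟨ cong (Y +_) (+-identityʳ Y) ⟨
        2 * Y                    ∎)
        where
        arrange : ∀ t d c → 2 * (2 * (t * (d * c))) ≡ 4 * (t * d) * c
        arrange = solve-∀
        arrange′ : ∀ z y → z * (1 + y) ≡ z + y * z
        arrange′ = solve-∀

      big-ok : All (λ q → Prime q × q ∤ M * P × Z ≤ q) L
      big-ok = All.tabulate λ {q} q∈L → ok (∈-filter⁻ (Z <?_) {xs = PrimeFactorisation.factors fac} q∈L)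
        where
        ok : ∀ {q} → q ∈ PrimeFactorisation.factors fac × Z < q → Prime q × q ∤ M * P × Z ≤ q
        ok {q} (q∈ , Z<q) = pq , q∤ , <⇒≤ Z<q
          where
          pq : Prime q
          pq = All.lookup (PrimeFactorisation.factorsPrime fac) q∈
          q∣m : q ∣ m
          q∣m = subst (q ∣_) (sym (PrimeFactorisation.isFactorisation fac)) (∈⇒∣product q∈)
          q∤ : q ∤ M * P
          q∤ q∣ with euclidsLemma M P pq q∣
          ... | inj₁ q∣M = M-smooth pq (m-rough pq q∣m) q∣M
          ... | inj₂ q∣P with prime∣primeProd largePrime-prime 0 Z pq q∣P
          ...   | i , i<Z , _ , refl = <⇒≱ Z<q i<Z

      G = ∑ X (λ x → 𝟙 (good Z x))

      RY≤2G : R * Y ≤ 2 * G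
      RY≤2G = sieve largePrime-prime largePrime≥ largePrime∤M Z L big-ok X Y c (m/n*n≤m X P) (m≤[1+m/n]*n Y Z) few

      R≥1 : 1 ≤ R
      R≥1 = ∏≥1 Z λ i _ → pick≥1 (largePrime i)

      P≤R : P ≤ R * (4 ^ (12 + 2 * d) * K) ^ d
      P≤R = subst (λ k → P ≤ R * (4 ^ (12 + 2 * d) * k) ^ d) (sym K≡)
        (subst (λ z → primeProd largePrime 0 z ≤ shiftedProd largePrime-prime d largePrime≥ z * (4 ^ (12 + 2 * d) * suc (suc (2 * a′))) ^ d)
          (sym (trans Z≡2^K (cong (2 ^_) K≡)))
          (mertens-product largePrime-prime d largePrime≥ (2 * a′)))
        where
        K≡ : K ≡ suc (suc (2 * a′))
        K≡ = *-suc 2 a′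

    -- A crude count, by which the gain outweighs the boundary loss M.
    Z≤2*good : Z ≤ 2 * ∑ X (λ x → 𝟙 (good Z x))
    Z≤2*good = ≤-trans Z≤Y (≤-trans (m≤n*m Y R {{>-nonZero R≥1}}) RY≤2G)

    sieveConst : ℕ
    sieveConst = 8 * M * (4 ^ (12 + 2 * d) * 2) ^ d

    n≤good : n ≤ sieveConst * (a ^ d * ∑ X (λ x → 𝟙 (good Z x)))
    n≤good = assemble M Y R P (4 ^ (12 + 2 * d)) d a G (≤-trans (≤-trans (s≤s z≤n) 4≤Z) Z≤Y) n≤2M[1+Y]P P≤R RY≤2G

-- Subsets of {1, …, n}

-- Extended by `false` beyond n, so that block sums may overrun n.
χ : ∀ {n} → Subset n → ℕ → Bool
χ []      _       = false
χ (b ∷ A) zero    = b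
χ (b ∷ A) (suc i) = χ A i

∣A∣≡∑χ : ∀ {n} (A : Subset n) → ∣ A ∣ ≡ ∑ n (λ i → 𝟙 (χ A i))
∣A∣≡∑χ []          = refl
∣A∣≡∑χ {suc n} (b ∷ A) = trans (head b) (sym (∑-split 1 n (λ i → 𝟙 (χ (b ∷ A) i))))
  where
  head : ∀ b → ∣ b ∷ A ∣ ≡ 𝟙 b + ∑ n (λ i → 𝟙 (χ A i))
  head true  = cong suc (∣A∣≡∑χ A)
  head false = ∣A∣≡∑χ A

Has : ∀ {n} → Subset n → ℕ → Set
Has A v = ∃[ j ] value j ≡ v × j ∈ₛ A

χ⇒Has : ∀ {n} (A : Subset n) i → χ A i ≡ true → Has A (suc i)
χ⇒Has (true ∷ A) zero    refl = Fin.zero , refl , here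
χ⇒Has (b ∷ A)    (suc i) e with χ⇒Has A i e
... | j , eq , j∈ = Fin.suc j , cong suc eq , there j∈

χ-tabulate : ∀ {n} (f : Fin n → Bool) i → χ (tabulate f) (toℕ i) ≡ f i
χ-tabulate f Fin.zero    = refl
χ-tabulate f (Fin.suc i) = χ-tabulate (f ∘ Fin.suc) i

χ-E : ∀ k n {i} (j : Fin k) → i < n → nthPrime (toℕ j) ∣ suc i → χ (E k n) i ≡ true
χ-E k n {i} j i<n p∣ = subst (λ v → χ (E k n) v ≡ true) (toℕ-fromℕ< i<n)
  (trans (χ-tabulate (λ v → does (any? {k} λ l → nthPrime (toℕ l) ∣? value v)) (Fin.fromℕ< i<n)) (true-does (any? {k} λ l → nthPrime (toℕ l) ∣? value (Fin.fromℕ< i<n))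
    (j , subst (λ v → nthPrime (toℕ j) ∣ suc v) (sym (toℕ-fromℕ< i<n)) p∣)))

∉E⇒∤ : ∀ k n {i} → i ∉ₛ E k n → ∀ (j : Fin k) → nthPrime (toℕ j) ∤ value i
∉E⇒∤ k n {i} i∉ j p∣ = i∉ (lookup⇒[]= i (E k n) (trans (lookup∘tabulate _ i)
  (true-does (any? {k} λ l → nthPrime (toℕ l) ∣? value i) (j , p∣))))

⊈⇒∃ : ∀ {n} {A B : Subset n} → A ⊈ B → ∃[ i ] i ∈ₛ A × i ∉ₛ B
⊈⇒∃ {A = A} {B} A⊈B with any? (λ i → (i ∈? A) ×-dec ¬? (i ∈? B))
... | yes p = p
... | no ¬p = ⊥-elim (A⊈B λ {i} i∈A → in-B i i∈A (i ∈? B))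
  where
  in-B : ∀ i → i ∈ₛ A → Dec (i ∈ₛ B) → i ∈ₛ B
  in-B i i∈A (yes i∈B) = i∈B
  in-B i i∈A (no i∉B)  = ⊥-elim (¬p (i , i∈A , i∉B))

∣⁅x⁆∪p∣ : ∀ {n} (x : Fin n) (p : Subset n) → x ∉ₛ p → ∣ ⁅ x ⁆ ∪ p ∣ ≡ suc ∣ p ∣
∣⁅x⁆∪p∣ Fin.zero    (true ∷ p)  x∉ = ⊥-elim (x∉ here)
∣⁅x⁆∪p∣ Fin.zero    (false ∷ p) x∉ = cong (suc ∘ ∣_∣) (∪-identityˡ p)
∣⁅x⁆∪p∣ (Fin.suc x) (true ∷ p)  x∉ = cong suc (∣⁅x⁆∪p∣ x p (x∉ ∘ there))
∣⁅x⁆∪p∣ (Fin.suc x) (false ∷ p) x∉ = ∣⁅x⁆∪p∣ x p (x∉ ∘ there)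

coprime⇒≢ : ∀ {u v} → 2 ≤ u → Coprime u v → u ≢ v
coprime⇒≢ 2≤u c refl = <⇒≢ 2≤u (sym (c (∣-refl , ∣-refl)))

module _ {n} {A S : Subset n} (S⊆A : S ⊆ A) (S-coprime : PairwiseCoprime S)
         {i : Fin n} (i∈A : i ∈ₛ A) (2≤i : 2 ≤ value i) (i-coprime : ∀ {j} → j ∈ₛ S → Coprime (value i) (value j)) where

  ∪-⊆ : ⁅ i ⁆ ∪ S ⊆ A
  ∪-⊆ x∈ with x∈p∪q⁻ ⁅ i ⁆ S x∈
  ... | inj₁ x∈i rewrite x∈⁅y⁆⇒x≡y i x∈i = i∈A
  ... | inj₂ x∈S = S⊆A x∈S

  ∪-card : ∣ ⁅ i ⁆ ∪ S ∣ ≡ suc ∣ S ∣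
  ∪-card = ∣⁅x⁆∪p∣ i S λ i∈S → coprime⇒≢ 2≤i (i-coprime i∈S) refl

  ∪-coprime : PairwiseCoprime (⁅ i ⁆ ∪ S)
  ∪-coprime {x} {y} x∈ y∈ x≢y with x∈p∪q⁻ ⁅ i ⁆ S x∈ | x∈p∪q⁻ ⁅ i ⁆ S y∈
  ... | inj₁ a | inj₁ b = ⊥-elim (x≢y (trans (x∈⁅y⁆⇒x≡y i a) (sym (x∈⁅y⁆⇒x≡y i b))))
  ... | inj₁ a | inj₂ b rewrite x∈⁅y⁆⇒x≡y i a = i-coprime b
  ... | inj₂ a | inj₁ b rewrite x∈⁅y⁆⇒x≡y i b = coprime-sym (i-coprime a)
  ... | inj₂ a | inj₂ b = S-coprime a b x≢y

⁅⁆-coprime : ∀ {n} (i : Fin n) → PairwiseCoprime ⁅ i ⁆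
⁅⁆-coprime i a b x≢y = ⊥-elim (x≢y (trans (x∈⁅y⁆⇒x≡y i a) (sym (x∈⁅y⁆⇒x≡y i b))))

⁅⁆-⊆ : ∀ {n} {A : Subset n} {i} → i ∈ₛ A → ⁅ i ⁆ ⊆ A
⁅⁆-⊆ {i = i} i∈A x∈ rewrite x∈⁅y⁆⇒x≡y i x∈ = i∈A

coprime-⁅⁆ : ∀ {n} {i j : Fin n} → Coprime (value i) (value j) → ∀ {x} → x ∈ₛ ⁅ j ⁆ → Coprime (value i) (value x)
coprime-⁅⁆ {j = j} c x∈ rewrite x∈⁅y⁆⇒x≡y j x∈ = c

-- 2 ≤ u makes the coprime u and v distinct, since only 1 is coprime to itself.
noPair : ∀ {n} {A : Subset n} → C 1 n A → ∀ {u v} → 2 ≤ u → Has A u → Has A v → ¬ Coprime u v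
noPair c 2≤u (i , refl , i∈) (j , refl , j∈) uv = c
  ( ⁅ i ⁆ ∪ ⁅ j ⁆ , ∪-⊆ (⁅⁆-⊆ j∈) (⁅⁆-coprime j) i∈ 2≤u (coprime-⁅⁆ uv)
  , trans (∪-card (⁅⁆-⊆ j∈) (⁅⁆-coprime j) i∈ 2≤u (coprime-⁅⁆ uv)) (cong suc (∣⁅x⁆∣≡1 j))
  , ∪-coprime (⁅⁆-⊆ j∈) (⁅⁆-coprime j) i∈ 2≤u (coprime-⁅⁆ uv))

noTriple : ∀ {n} {A : Subset n} → C 2 n A → ∀ {u v w} → 2 ≤ u → 2 ≤ v → Has A u → Has A v → Has A w →
           Coprime u v → Coprime u w → ¬ Coprime v w
noTriple {n} {A} c 2≤u 2≤v (i , refl , i∈) (j , refl , j∈) (k , refl , k∈) uv uw vw = c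
  ( ⁅ i ⁆ ∪ S , ∪-⊆ S⊆ S-coprime i∈ 2≤u i-coprime
  , trans (∪-card S⊆ S-coprime i∈ 2≤u i-coprime)
      (cong suc (trans (∪-card (⁅⁆-⊆ k∈) (⁅⁆-coprime k) j∈ 2≤v (coprime-⁅⁆ vw)) (cong suc (∣⁅x⁆∣≡1 k))))
  , ∪-coprime S⊆ S-coprime i∈ 2≤u i-coprime)
  where
  S : Subset n
  S = ⁅ j ⁆ ∪ ⁅ k ⁆
  S⊆ : S ⊆ A
  S⊆ = ∪-⊆ (⁅⁆-⊆ k∈) (⁅⁆-coprime k) j∈ 2≤v (coprime-⁅⁆ vw)
  S-coprime : PairwiseCoprime S
  S-coprime = ∪-coprime (⁅⁆-⊆ k∈) (⁅⁆-coprime k) j∈ 2≤v (coprime-⁅⁆ vw)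
  i-coprime : ∀ {x} → x ∈ₛ S → Coprime (value i) (value x)
  i-coprime x∈ with x∈p∪q⁻ ⁅ j ⁆ ⁅ k ⁆ x∈
  ... | inj₁ a = coprime-⁅⁆ uv a
  ... | inj₂ a = coprime-⁅⁆ uw a

-- Block x + 1 of A is compared with block x of E. The first M places of A are counted trivially,
-- the shifted blocks also cover the incomplete last one, and all blocks of E in use are full.
count-blocks : ∀ {n} (A E : Subset n) M .{{_ : NonZero M}} e (g : ℕ → Bool) →
  (∀ x → ∑ M (λ r → 𝟙 (χ A (M + (x * M + r)))) + 𝟙 (g x) ≤ e) →
  (∀ x → (∀ r → r < M → x * M + r < n) → e ≤ ∑ M (λ r → 𝟙 (χ E (x * M + r)))) →
  ∣ A ∣ + ∑ (n / M) (λ x → 𝟙 (g x)) ≤ M + ∣ E ∣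
count-blocks {n} A E M e g A≤ E≥ = begin
  ∣ A ∣ + G                                        ≡⟨ cong (_+ G) (∣A∣≡∑χ A) ⟩
  ∑ n a + G                                        ≤⟨ +-monoˡ-≤ G (∑-monoˡ a n≤) ⟩
  ∑ (M + X * M) a + G                              ≡⟨ cong (_+ G) (∑-split M (X * M) a) ⟩
  ∑ M a + ∑ (X * M) (λ i → a (M + i)) + G          ≤⟨ +-monoˡ-≤ G (+-mono-≤ first (≤-reflexive (∑-blocks X M (λ i → a (M + i))))) ⟩
  M + ∑ X blockA + G                               ≡⟨ +-assoc M _ G ⟩
  M + (∑ X blockA + G)                             ≡⟨ cong (M +_) (∑-distrib-+ X blockA (λ x → 𝟙 (g x))) ⟨
  M + ∑ X (λ x → blockA x + 𝟙 (g x))               ≤⟨ +-monoʳ-≤ M (∑-mono X (λ x x<X → ≤-trans (A≤ x) (E≥ x (inside-n x x<X)))) ⟩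
  M + ∑ X (λ x → ∑ M (λ r → 𝟙 (χ E (x * M + r))))  ≡⟨ cong (M +_) (∑-blocks X M (λ i → 𝟙 (χ E i))) ⟨
  M + ∑ (X * M) (λ i → 𝟙 (χ E i))                  ≤⟨ +-monoʳ-≤ M (∑-monoˡ (λ i → 𝟙 (χ E i)) (m/n*n≤m n M)) ⟩
  M + ∑ n (λ i → 𝟙 (χ E i))                        ≡⟨ cong (M +_) (∣A∣≡∑χ E) ⟨
  M + ∣ E ∣                                        ∎
  where
  open ≤-Reasoning
  X = n / M
  G = ∑ X (λ x → 𝟙 (g x))
  a blockA : ℕ → ℕ
  a i = 𝟙 (χ A i)
  blockA x = ∑ M (λ r → 𝟙 (χ A (M + (x * M + r))))
  n≤ : n ≤ M + X * M
  n≤ = ≤-trans (≤-reflexive (m≡m%n+[m/n]*n n M)) (+-monoˡ-≤ (X * M) (<⇒≤ (m%n<n n M)))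
  first : ∑ M a ≤ M
  first = ≤-trans (∑-mono M (λ i _ → 𝟙≤1 (χ A i))) (≤-reflexive (trans (∑-const M 1) (*-identityʳ M)))
  inside-n : ∀ x → x < X → ∀ r → r < M → x * M + r < n
  inside-n x x<X r r<M = begin-strict
    x * M + r    <⟨ +-monoʳ-< (x * M) r<M ⟩
    x * M + M    ≡⟨ +-comm (x * M) M ⟩
    suc x * M    ≤⟨ *-monoˡ-≤ M x<X ⟩
    X * M        ≤⟨ m/n*n≤m n M ⟩
    n            ∎

-- Comparison of A with E k n

-- E - A ≥ G - M ≥ G/2, which doubles s.
absorb-boundary : ∀ {M A E G w s n} → 2 * M ≤ G → A + G ≤ M + E → n ≤ s * (w * G) →
                  ∃[ δ ] E ≡ A + δ × n ≤ 2 * s * (w * δ)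
absorb-boundary {M} {A} {E} {G} {w} {s} {n} 2M≤G h n≤ = δ , E≡ , (begin
  n                   ≤⟨ n≤ ⟩
  s * (w * G)         ≤⟨ *-monoʳ-≤ s (*-monoʳ-≤ w G≤2δ) ⟩
  s * (w * (2 * δ))   ≡⟨ arrange s w δ ⟩
  2 * s * (w * δ)     ∎)
  where
  open ≤-Reasoning
  δ = E ∸ A
  A≤E : A ≤ E
  A≤E = +-cancelˡ-≤ M _ _ (begin
    M + A   ≡⟨ +-comm M A ⟩
    A + M   ≤⟨ +-monoʳ-≤ A (≤-trans (m≤m+n M _) 2M≤G) ⟩
    A + G   ≤⟨ h ⟩
    M + E   ∎)
  E≡ : E ≡ A + δ
  E≡ = sym (m+[n∸m]≡n A≤E)
  G≤2δ : G ≤ 2 * δ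
  G≤2δ = +-cancelˡ-≤ (A + A + G) _ _ (begin
    A + A + G + G         ≡⟨ eq₁ A G ⟩
    2 * (A + G)           ≤⟨ *-monoʳ-≤ 2 h ⟩
    2 * (M + E)           ≡⟨ cong (λ e → 2 * (M + e)) E≡ ⟩
    2 * (M + (A + δ))     ≡⟨ eq₂ M A δ ⟩
    A + A + 2 * M + 2 * δ ≤⟨ +-monoˡ-≤ (2 * δ) (+-monoʳ-≤ (A + A) 2M≤G) ⟩
    A + A + G + 2 * δ     ∎)
    where
    eq₁ : ∀ A G → A + A + G + G ≡ 2 * (A + G)
    eq₁ = solve-∀
    eq₂ : ∀ M A δ → 2 * (M + (A + δ)) ≡ A + A + 2 * M + 2 * δ
    eq₂ = solve-∀
  arrange : ∀ s w δ → s * (w * (2 * δ)) ≡ 2 * s * (w * δ)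
  arrange = solve-∀

-- The sieve constant, doubled by `absorb-boundary`; opaque so that the large numeral is never
-- computed.
abstract
  gapConst : ℕ → ℕ → ℕ
  gapConst M d = 2 * (8 * M * (4 ^ (12 + 2 * d) * 2) ^ d)

  gapConst-def : ∀ M d → gapConst M d ≡ 2 * (8 * M * (4 ^ (12 + 2 * d) * 2) ^ d)
  gapConst-def M d = refl

-- The argument common to both k. `e` bounds the elements of E per block from below; the Boolean b,
-- later `good Z x`, converts coprimality to m into one element gained.
gap : ∀ M .{{_ : NonZero M}} (B : List ℕ) .{{_ : NonZero (length B)}} → M ≤ 8 →
      (∀ {p} → Prime p → length B < p → p ∤ M) →
      ∀ {n} (A E : Subset n) {m} .{{_ : NonZero m}} → m ≤ n → (∀ {p} → Prime p → p ∣ m → length B < p) →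
      ∀ e → (∀ x b → (b ≡ true → ∀ {c} → c ∈ B → Coprime (M * x + c) m) →
               ∑ M (λ r → 𝟙 (χ A (M + (x * M + r)))) + 𝟙 b ≤ e) →
            (∀ x → (∀ r → r < M → x * M + r < n) → e ≤ ∑ M (λ r → 𝟙 (χ E (x * M + r)))) →
      ∀ a → 64 * length B ≤ suc a → ∀ {Z} → Z ≡ 4 ^ suc a → 4 ^ (4 * Z) ≤ n → n < 4 ^ (16 * Z) →
      ∃[ δ ] ∣ E ∣ ≡ ∣ A ∣ + δ × n ≤ gapConst M (length B) * (suc a ^ length B * δ)
gap M B M≤8 M-smooth {n} A E {m} m≤n m-rough e A≤ E≥ a a-large {Z} Z≡ n-lower n-upper =
  subst (λ K → ∃[ δ ] ∣ E ∣ ≡ ∣ A ∣ + δ × n ≤ K * (suc a ^ length B * δ)) (sym (gapConst-def M (length B)))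
    (absorb-boundary {w = suc a ^ length B} {s = 8 * M * (4 ^ (12 + 2 * length B) * 2) ^ length B} 2M≤G
    (count-blocks A E M e (good Z) (λ x → A≤ x (good Z x) λ gx → good⇒coprime Z gx) E≥)
    n≤good)
  where
  open ≤-Reasoning
  open Forms M B M≤8 M-smooth (factorise m) m-rough
  4M≤Z : 4 * M ≤ Z
  4M≤Z = begin
    4 * M             ≤⟨ *-monoʳ-≤ 4 M≤8 ⟩
    32                ≤⟨ m≤m+n 32 32 ⟩
    64                ≤⟨ m≤m*n 64 (length B) ⟩
    64 * length B     ≤⟨ a-large ⟩
    suc a             ≤⟨ <⇒≤ (n<4^n (suc a)) ⟩
    4 ^ suc a         ≡⟨ Z≡ ⟨
    Z                 ∎
  M≤n : M ≤ n
  M≤n = begin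
    M             ≤⟨ m≤n*m M 4 ⟩
    4 * M         ≤⟨ 4M≤Z ⟩
    Z             ≤⟨ m≤n*m Z 4 ⟩
    4 * Z         ≤⟨ <⇒≤ (n<4^n (4 * Z)) ⟩
    4 ^ (4 * Z)   ≤⟨ n-lower ⟩
    n             ∎
  n≤2MX : n ≤ 2 * M * (n / M)
  n≤2MX = begin
    n                       ≤⟨ m≤[1+m/n]*n n M ⟩
    (1 + n / M) * M         ≤⟨ *-monoˡ-≤ M (+-monoˡ-≤ (n / M) (m≥n⇒m/n>0 M≤n)) ⟩
    (n / M + n / M) * M     ≡⟨ arrange M (n / M) ⟩
    2 * M * (n / M)         ∎
    where
    arrange : ∀ M X → (X + X) * M ≡ 2 * M * X
    arrange = solve-∀
  open Count a Z≡ a-large m≤n n-lower n-upper (n / M) n≤2MX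
  2M≤G : 2 * M ≤ ∑ (n / M) (λ x → 𝟙 (good Z x))
  2M≤G = *-cancelˡ-≤ 2 (≤-trans (≤-reflexive (sym (*-assoc 2 2 M))) (≤-trans 4M≤Z Z≤2*good))

-- Blocks of length 2 and 6

forms-≥2 : ∀ M x c → 2 ≤ M + suc c → 2 ≤ suc (M + (x * M + c))
forms-≥2 M x c h = ≤-trans h (≤-trans (≤-reflexive (+-suc M c)) (s≤s (+-monoʳ-≤ M (m≤n+m c (x * M)))))

-- `a` and `b` are memberships in A, and `g` says that both numbers are coprime to m, which then
-- forms a forbidden pair with either.
block₁-bound : ∀ a b g → (a ≡ true → b ≡ true → ⊥) → (g ≡ true → a ≡ true → ⊥) → (g ≡ true → b ≡ true → ⊥) →
               𝟙 a + 𝟙 b + 𝟙 g ≤ 1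
block₁-bound true  true  _     h _ _ = ⊥-elim (h refl refl)
block₁-bound true  false true  _ h _ = ⊥-elim (h refl refl)
block₁-bound true  false false _ _ _ = ≤-refl
block₁-bound false true  true  _ _ h = ⊥-elim (h refl refl)
block₁-bound false true  false _ _ _ = ≤-refl
block₁-bound false false g     _ _ _ = 𝟙≤1 g

-- Four pairwise coprime numbers: no three lie in A, and under `g` no two, since m would complete a
-- triple.
block₂-bound : ∀ a b c e g →
  (a ≡ true → b ≡ true → c ≡ true → ⊥) → (a ≡ true → b ≡ true → e ≡ true → ⊥) →
  (a ≡ true → c ≡ true → e ≡ true → ⊥) → (b ≡ true → c ≡ true → e ≡ true → ⊥) →
  (g ≡ true → a ≡ true → b ≡ true → ⊥) → (g ≡ true → a ≡ true → c ≡ true → ⊥) → (g ≡ true → a ≡ true → e ≡ true → ⊥) →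
  (g ≡ true → b ≡ true → c ≡ true → ⊥) → (g ≡ true → b ≡ true → e ≡ true → ⊥) → (g ≡ true → c ≡ true → e ≡ true → ⊥) →
  𝟙 a + 𝟙 b + 𝟙 c + 𝟙 e + 𝟙 g ≤ 2
block₂-bound true  true  true  _     _     h _ _ _ _ _ _ _ _ _ = ⊥-elim (h refl refl refl)
block₂-bound true  true  false true  _     _ h _ _ _ _ _ _ _ _ = ⊥-elim (h refl refl refl)
block₂-bound true  false true  true  _     _ _ h _ _ _ _ _ _ _ = ⊥-elim (h refl refl refl)
block₂-bound false true  true  true  _     _ _ _ h _ _ _ _ _ _ = ⊥-elim (h refl refl refl)
block₂-bound true  true  false false true  _ _ _ _ h _ _ _ _ _ = ⊥-elim (h refl refl refl)
block₂-bound true  false true  false true  _ _ _ _ _ h _ _ _ _ = ⊥-elim (h refl refl refl)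
block₂-bound true  false false true  true  _ _ _ _ _ _ h _ _ _ = ⊥-elim (h refl refl refl)
block₂-bound false true  true  false true  _ _ _ _ _ _ _ h _ _ = ⊥-elim (h refl refl refl)
block₂-bound false true  false true  true  _ _ _ _ _ _ _ _ h _ = ⊥-elim (h refl refl refl)
block₂-bound false false true  true  true  _ _ _ _ _ _ _ _ _ h = ⊥-elim (h refl refl refl)
block₂-bound true  true  false false false _ _ _ _ _ _ _ _ _ _ = ≤-refl
block₂-bound true  false true  false false _ _ _ _ _ _ _ _ _ _ = ≤-refl
block₂-bound true  false false true  false _ _ _ _ _ _ _ _ _ _ = ≤-refl
block₂-bound false true  true  false false _ _ _ _ _ _ _ _ _ _ = ≤-refl
block₂-bound false true  false true  false _ _ _ _ _ _ _ _ _ _ = ≤-refl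
block₂-bound false false true  true  false _ _ _ _ _ _ _ _ _ _ = ≤-refl
block₂-bound true  false false false g     _ _ _ _ _ _ _ _ _ _ = s≤s (𝟙≤1 g)
block₂-bound false true  false false g     _ _ _ _ _ _ _ _ _ _ = s≤s (𝟙≤1 g)
block₂-bound false false true  false g     _ _ _ _ _ _ _ _ _ _ = s≤s (𝟙≤1 g)
block₂-bound false false false true  g     _ _ _ _ _ _ _ _ _ _ = s≤s (𝟙≤1 g)
block₂-bound false false false false g     _ _ _ _ _ _ _ _ _ _ = ≤-trans (𝟙≤1 g) (s≤s z≤n)

coprime-+ : ∀ {u} k → (∀ {d} → d ∣ u → d ∣ k → d ∣ 1) → Coprime u (u + k)
coprime-+ k h (d∣u , d∣u+k) = ∣1⇒≡1 (h d∣u (∣m+n∣m⇒∣n d∣u+k d∣u))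

gap₁ : ∀ {n} (A : Subset n) → C 1 n A → A ⊈ E 1 n →
  ∀ a → 128 ≤ suc a → ∀ {Z} → Z ≡ 4 ^ suc a → 4 ^ (4 * Z) ≤ n → n < 4 ^ (16 * Z) →
  ∃[ δ ] ∣ E 1 n ∣ ≡ ∣ A ∣ + δ × n ≤ gapConst 2 2 * (suc a ^ 2 * δ)
gap₁ {n} A cA A⊈E with ⊈⇒∃ A⊈E
-- 3 and 4 are 1 and 2 moved by one block, to match the shift in `count-blocks`.
... | i , i∈A , i∉E = gap 2 (3 ∷ 4 ∷ []) (s≤s (s≤s z≤n)) (λ pp 2<p p∣2 → <⇒≱ 2<p (∣⇒≤ p∣2)) A (E 1 n) (toℕ<n i)
  rough 1 blocks E-blocks
  where
  m = value i
  rough : ∀ {p} → Prime p → p ∣ m → 2 < p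
  rough pp p∣m = ≤∧≢⇒< (prime≥2 pp) λ { refl → ∉E⇒∤ 1 n i∉E Fin.zero p∣m }
  E-blocks : ∀ x → (∀ r → r < 2 → x * 2 + r < n) → 1 ≤ ∑ 2 (λ r → 𝟙 (χ (E 1 n) (x * 2 + r)))
  E-blocks x h = ≤-trans (≤-reflexive (cong 𝟙 (sym (χ-E 1 n Fin.zero (h 1 ≤-refl)
      (divides (suc x) (arrange x)))))) (m≤n+m _ _)
    where
    arrange : ∀ x → 1 + (x * 2 + 1) ≡ (1 + x) * 2
    arrange = solve-∀
  blocks : ∀ x b → (b ≡ true → ∀ {c} → c ∈ 3 ∷ 4 ∷ [] → Coprime (2 * x + c) m) →
           ∑ 2 (λ r → 𝟙 (χ A (2 + (x * 2 + r)))) + 𝟙 b ≤ 1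
  blocks x b h = block₁-bound (χ A (2 + (x * 2 + 0))) (χ A (2 + (x * 2 + 1))) b
    (λ p q → noPair cA (forms-≥2 2 x 0 (s≤s (s≤s z≤n))) (χ⇒Has A _ p) (χ⇒Has A _ q)
       (subst (Coprime _) (shift x) (coprime-+ 1 (λ _ d → d))))
    (λ g p → noPair cA (forms-≥2 2 x 0 (s≤s (s≤s z≤n))) (χ⇒Has A _ p) (i , refl , i∈A)
       (subst (λ v → Coprime v m) (form₀ x) (h g (here refl))))
    (λ g p → noPair cA (forms-≥2 2 x 1 (s≤s (s≤s z≤n))) (χ⇒Has A _ p) (i , refl , i∈A)
       (subst (λ v → Coprime v m) (form₁ x) (h g (there (here refl)))))
    where
    shift : ∀ x → 1 + (2 + (x * 2 + 0)) + 1 ≡ 1 + (2 + (x * 2 + 1))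
    shift = solve-∀
    form₀ : ∀ x → 2 * x + 3 ≡ 1 + (2 + (x * 2 + 0))
    form₀ = solve-∀
    form₁ : ∀ x → 2 * x + 4 ≡ 1 + (2 + (x * 2 + 1))
    form₁ = solve-∀

-- A common divisor divides the difference of the residues, one of 1, 2, 3, 4; reduction modulo 2 or
-- 3 then forces it to be 1.
module Residues (y : ℕ) where

  private
    D = 6 * y

  2∣D : 2 ∣ D
  2∣D = ∣m⇒∣m*n y (divides 3 refl)

  3∣D : 3 ∣ D
  3∣D = ∣m⇒∣m*n y (divides 2 refl)

  2∣⇒1 : ∀ {d} → d ∣ D + 1 → d ∣ 2 → d ∣ 1
  2∣⇒1 h d∣2 = ∣m+n∣m⇒∣n h (∣-trans d∣2 2∣D)

  r₁r₂ : Coprime (D + 1) (D + 1 + 1)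
  r₁r₂ = coprime-+ 1 λ _ d∣1 → d∣1

  r₁r₃ : Coprime (D + 1) (D + 1 + 2)
  r₁r₃ = coprime-+ 2 2∣⇒1

  r₁r₅ : Coprime (D + 1) (D + 1 + 4)
  -- d ∣ 4 ∣ 2 D and d ∣ 2 D + 2 give d ∣ 2, the situation of `r₁r₃`.
  r₁r₅ = coprime-+ 4 λ {d} h d∣4 → 2∣⇒1 h
    (∣m+n∣m⇒∣n (subst (d ∣_) (arrange D) (∣n⇒∣m*n 2 h)) (∣-trans d∣4 4∣2D))
    where
    arrange : ∀ D → 2 * (D + 1) ≡ 2 * D + 2
    arrange = solve-∀
    4∣2D : 4 ∣ 2 * D
    4∣2D = subst (4 ∣_) (*-assoc 2 6 y) (∣m⇒∣m*n y (divides 3 refl))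

  r₂r₃ : Coprime (D + 2) (D + 2 + 1)
  r₂r₃ = coprime-+ 1 λ _ d∣1 → d∣1

  r₂r₅ : Coprime (D + 2) (D + 2 + 3)
  r₂r₅ = coprime-+ 3 λ h d∣3 → ∣m+n∣m⇒∣n d∣3 (∣m+n∣m⇒∣n h (∣-trans d∣3 3∣D))

  r₃r₅ : Coprime (D + 3) (D + 3 + 2)
  r₃r₅ = coprime-+ 2 λ h d∣2 → ∣m+n∣m⇒∣n (∣m+n∣m⇒∣n h (∣-trans d∣2 2∣D)) d∣2

gap₂ : ∀ {n} (A : Subset n) → C 2 n A → A ⊈ E 2 n →
  ∀ a → 256 ≤ suc a → ∀ {Z} → Z ≡ 4 ^ suc a → 4 ^ (4 * Z) ≤ n → n < 4 ^ (16 * Z) →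
  ∃[ δ ] ∣ E 2 n ∣ ≡ ∣ A ∣ + δ × n ≤ gapConst 6 4 * (suc a ^ 4 * δ)
gap₂ {n} A cA A⊈E with ⊈⇒∃ A⊈E
-- 6 + b for b = 1, 2, 3, 5. The later 4 counts the residues 2, 3, 4, 6 that `E 2 n` contains in
-- each block.
... | i , i∈A , i∉E = gap 6 (7 ∷ 8 ∷ 9 ∷ 11 ∷ []) (m≤m+n 6 2) smooth A (E 2 n) (toℕ<n i)
  rough 4 blocks E-blocks
  where
  m = value i
  smooth : ∀ {p} → Prime p → 4 < p → p ∤ 6
  smooth pp 4<p p∣6 with euclidsLemma 2 3 pp p∣6
  ... | inj₁ p∣2 = <⇒≱ 4<p (≤-trans (∣⇒≤ p∣2) (m≤m+n 2 2))
  ... | inj₂ p∣3 = <⇒≱ 4<p (≤-trans (∣⇒≤ p∣3) (m≤m+n 3 1))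
  rough : ∀ {p} → Prime p → p ∣ m → 4 < p
  -- The bound is d = 4, so besides the primes 2 and 3 also the composite 4 is excluded.
  rough pp p∣m = ≤∧≢⇒< (≤∧≢⇒< (≤∧≢⇒< (prime≥2 pp)
    λ { refl → ∉E⇒∤ 2 n i∉E Fin.zero p∣m })
    λ { refl → ∉E⇒∤ 2 n i∉E (Fin.suc Fin.zero) p∣m })
    λ { refl → prime⇒¬composite pp composite[4] }
  E-blocks : ∀ x → (∀ r → r < 6 → x * 6 + r < n) → 4 ≤ ∑ 6 (λ r → 𝟙 (χ (E 2 n) (x * 6 + r)))
  E-blocks x h = +-mono-≤ (+-mono-≤ (+-mono-≤ (+-mono-≤ (+-mono-≤ (z≤n {0 + 𝟙 (χ (E 2 n) (x * 6 + 0))})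
      (in-E Fin.zero (m≤m+n 2 4) (divides (1 + x * 3) (eq₁ x))))
      (in-E (Fin.suc Fin.zero) (m≤m+n 3 3) (divides (1 + x * 2) (eq₂ x))))
      (in-E Fin.zero (m≤m+n 4 2) (divides (2 + x * 3) (eq₃ x))))
      (z≤n {𝟙 (χ (E 2 n) (x * 6 + 4))}))
      (in-E Fin.zero (m≤m+n 6 0) (divides (3 + x * 3) (eq₅ x)))
    where
    in-E : ∀ {r} (j : Fin 2) → r < 6 → nthPrime (toℕ j) ∣ suc (x * 6 + r) → 1 ≤ 𝟙 (χ (E 2 n) (x * 6 + r))
    in-E {r} j r<6 d = ≤-reflexive (cong 𝟙 (sym (χ-E 2 n j (h r r<6) d)))
    eq₁ : ∀ x → 1 + (x * 6 + 1) ≡ (1 + x * 3) * 2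
    eq₁ = solve-∀
    eq₂ : ∀ x → 1 + (x * 6 + 2) ≡ (1 + x * 2) * 3
    eq₂ = solve-∀
    eq₃ : ∀ x → 1 + (x * 6 + 3) ≡ (2 + x * 3) * 2
    eq₃ = solve-∀
    eq₅ : ∀ x → 1 + (x * 6 + 5) ≡ (3 + x * 3) * 2
    eq₅ = solve-∀
  blocks : ∀ x b → (b ≡ true → ∀ {c} → c ∈ 7 ∷ 8 ∷ 9 ∷ 11 ∷ [] → Coprime (6 * x + c) m) →
           ∑ 6 (λ r → 𝟙 (χ A (6 + (x * 6 + r)))) + 𝟙 b ≤ 4
  blocks x b h = begin
    0 + a 0 + a 1 + a 2 + a 3 + a 4 + a 5 + 𝟙 b   ≡⟨ regroup (a 0) (a 1) (a 2) (a 3) (a 4) (a 5) (𝟙 b) ⟩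
    -- Offsets 3 and 5, the residues 4 and 6, are counted trivially.
    (a 0 + a 1 + a 2 + a 4 + 𝟙 b) + (a 3 + a 5)   ≤⟨ +-mono-≤ four (+-mono-≤ (𝟙≤1 (χ A (6 + (x * 6 + 3)))) (𝟙≤1 (χ A (6 + (x * 6 + 5))))) ⟩
    4                                             ∎
    where
    open ≤-Reasoning
    open Residues (suc x)
    a : ℕ → ℕ
    a r = 𝟙 (χ A (6 + (x * 6 + r)))
    regroup : ∀ a b c d e f g → 0 + a + b + c + d + e + f + g ≡ (a + b + c + e + g) + (d + f)
    regroup = solve-∀
    v : ℕ → ℕ
    v r = suc (6 + (x * 6 + r))
    v≡ : ∀ r → v r ≡ 6 * suc x + suc r
    v≡ = expand x
      where
      expand : ∀ x r → 1 + (6 + (x * 6 + r)) ≡ 6 * (1 + x) + (1 + r)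
      expand = solve-∀
    coprime-v : ∀ r k → Coprime (6 * suc x + suc r) (6 * suc x + suc r + k) → Coprime (v r) (v (r + k))
    coprime-v r k = subst₂ Coprime (sym (v≡ r)) (trans (+-assoc (6 * suc x) (suc r) k) (sym (v≡ (r + k))))
    2≤v : ∀ r → 2 ≤ v r
    2≤v r = s≤s (s≤s z≤n)
    form : ∀ r → 6 * x + (7 + r) ≡ v r
    form = expand x
      where
      expand : ∀ x r → 6 * x + (7 + r) ≡ 1 + (6 + (x * 6 + r))
      expand = solve-∀
    triple : ∀ r s t → Coprime (v r) (v s) → Coprime (v r) (v t) → Coprime (v s) (v t) →
      χ A (6 + (x * 6 + r)) ≡ true → χ A (6 + (x * 6 + s)) ≡ true → χ A (6 + (x * 6 + t)) ≡ true → ⊥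
    triple r s t rs rt st p q w = noTriple cA (2≤v r) (2≤v s) (χ⇒Has A _ p) (χ⇒Has A _ q) (χ⇒Has A _ w) rs rt st
    pair : ∀ r s → 7 + r ∈ 7 ∷ 8 ∷ 9 ∷ 11 ∷ [] → 7 + s ∈ 7 ∷ 8 ∷ 9 ∷ 11 ∷ [] → Coprime (v r) (v s) →
      b ≡ true → χ A (6 + (x * 6 + r)) ≡ true → χ A (6 + (x * 6 + s)) ≡ true → ⊥
    pair r s r∈ s∈ rs g p q = noTriple cA (2≤v r) (2≤v s) (χ⇒Has A _ p) (χ⇒Has A _ q) (i , refl , i∈A)
      rs (subst (λ u → Coprime u m) (form r) (h g r∈)) (subst (λ u → Coprime u m) (form s) (h g s∈))
    c₀₁ : Coprime (v 0) (v 1)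
    c₀₁ = coprime-v 0 1 r₁r₂
    c₀₂ : Coprime (v 0) (v 2)
    c₀₂ = coprime-v 0 2 r₁r₃
    c₀₄ : Coprime (v 0) (v 4)
    c₀₄ = coprime-v 0 4 r₁r₅
    c₁₂ : Coprime (v 1) (v 2)
    c₁₂ = coprime-v 1 1 r₂r₃
    c₁₄ : Coprime (v 1) (v 4)
    c₁₄ = coprime-v 1 3 r₂r₅
    c₂₄ : Coprime (v 2) (v 4)
    c₂₄ = coprime-v 2 2 r₃r₅
    m₀ : 7 ∈ 7 ∷ 8 ∷ 9 ∷ 11 ∷ []
    m₀ = here refl
    m₁ : 8 ∈ 7 ∷ 8 ∷ 9 ∷ 11 ∷ []
    m₁ = there (here refl)
    m₂ : 9 ∈ 7 ∷ 8 ∷ 9 ∷ 11 ∷ []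
    m₂ = there (there (here refl))
    m₄ : 11 ∈ 7 ∷ 8 ∷ 9 ∷ 11 ∷ []
    m₄ = there (there (there (here refl)))
    four : a 0 + a 1 + a 2 + a 4 + 𝟙 b ≤ 2
    four = block₂-bound (χ A (6 + (x * 6 + 0))) (χ A (6 + (x * 6 + 1))) (χ A (6 + (x * 6 + 2))) (χ A (6 + (x * 6 + 4))) b
      (triple 0 1 2 c₀₁ c₀₂ c₁₂) (triple 0 1 4 c₀₁ c₀₄ c₁₄) (triple 0 2 4 c₀₂ c₀₄ c₂₄) (triple 1 2 4 c₁₂ c₁₄ c₂₄)
      (pair 0 1 m₀ m₁ c₀₁) (pair 0 2 m₀ m₂ c₀₂) (pair 0 4 m₀ m₄ c₀₄)
      (pair 1 2 m₁ m₂ c₁₂) (pair 1 4 m₁ m₄ c₁₄) (pair 2 4 m₂ m₄ c₂₄)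

-- Existence of the maximum

-- Downward search from n: a size that is not attained lowers the bound by one, and the given member
-- stops the search.
maxCard : ∀ {n} {F : Subset n → Set} → (∀ A → Dec (F A)) → ∀ A → F A → ∃[ M ] IsMaxCard F M
maxCard {n} {F} F? A FA = search n λ B _ → ∣p∣≤n B
  where
  search : ∀ k → (∀ B → F B → ∣ B ∣ ≤ k) → ∃[ M ] IsMaxCard F M
  search k bound with anySubset? (λ B → F? B ×-dec (∣ B ∣ ≟ k))
  ... | yes w = k , w , bound
  search zero    bound | no ¬w = ⊥-elim (¬w (A , FA , n≤0⇒n≡0 (bound A FA)))
  search (suc k) bound | no ¬w = search k λ B FB →
    s≤s⁻¹ (≤∧≢⇒< (bound B FB) λ eq → ¬w (B , FB , eq))

pairwiseCoprime? : ∀ {n} (S : Subset n) → Dec (PairwiseCoprime S)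
pairwiseCoprime? S = map′ (λ h {i} {j} → h i j) (λ h i j → h {i} {j})
  (all? λ i → all? λ j → (i ∈? S) →-dec ((j ∈? S) →-dec (¬? (i Fin.≟ j) →-dec coprime? (value i) (value j))))

C? : ∀ k n A → Dec (C k n A)
C? k n A = ¬? (anySubset? λ S → (S ⊆? A) ×-dec ((∣ S ∣ ≟ suc k) ×-dec pairwiseCoprime? S))

∈E⇒∣ : ∀ k n {i} → i ∈ₛ E k n → ∃[ j ] nthPrime (toℕ {k} j) ∣ value i
∈E⇒∣ k n {i} i∈E = does-true (any? λ j → nthPrime (toℕ j) ∣? value i)
  (trans (sym (lookup∘tabulate _ i)) ([]=⇒lookup i∈E))

-- The set containing only the number 1 (index 0) belongs to the family: it is too small for k + 1
-- elements, and no prime divides 1.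
exists-max : ∀ k n → (∀ (j : Fin k) → nthPrime (toℕ j) ∤ 1) → 1 ≤ k → 1 ≤ n →
             ∃[ M ] IsMaxCard (λ A → C k n A × A ⊈ E k n) M
exists-max k (suc n) ∤1 1≤k 1≤n = maxCard (λ A → C? k (suc n) A ×-dec ¬? (A ⊆? E k (suc n))) ⁅ Fin.zero ⁆ (in-C , not-in-E)
  where
  in-C : C k (suc n) ⁅ Fin.zero ⁆
  in-C (S , S⊆ , ∣S∣≡ , _) = <⇒≱ (s≤s 1≤k)
    (subst₂ _≤_ ∣S∣≡ (∣⁅x⁆∣≡1 (Fin.zero {n})) (p⊆q⇒∣p∣≤∣q∣ S⊆))
  not-in-E : ⁅ Fin.zero ⁆ ⊈ E k (suc n)
  not-in-E ⊆E with ∈E⇒∣ k (suc n) (⊆E (x∈⁅x⁆ Fin.zero))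
  ... | j , p∣1 = ∤1 j p∣1

-- Rational bounds for real operations

import Defs
open import Data.Integer as ℤ using (ℤ; +_; _-_)
import Data.Integer.Properties as ℤ
open import Data.Rational as ℚ using (ℚ; mkℚ; 0ℚ; 1ℚ; *≤*; *<*)
import Data.Rational.Properties as ℚ
open import Algebra.Bundles using (CommutativeRing)
import Algebra.Properties.CommutativeSemiring.Exp (CommutativeRing.commutativeSemiring ℚ.+-*-commutativeRing) as Exp

-- By Bernoulli, 1 + T/m ≤ (1 + 1/(2m))^(2T); the m-th power is at most 2^(2T) because (1 +
-- 1/(2m))^m ≤ 2.
[1+T/m]^m≤4^T : ∀ m T .{{_ : NonZero m}} → (m + T) ^ m ≤ 4 ^ T * m ^ m
[1+T/m]^m≤4^T m T = *-cancelˡ-≤ (2 ^ m) {{m^n≢0 2 m}} (*-cancelʳ-≤ _ _ (D ^ (2 * T * m)) {{m^n≢0 D (2 * T * m)}} (begin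
  2 ^ m * (m + T) ^ m * D ^ (2 * T * m)          ≡⟨ cong (_* D ^ (2 * T * m)) (^-distribʳ-* m 2 (m + T)) ⟨
  (2 * (m + T)) ^ m * D ^ (2 * T * m)            ≡⟨ cong₂ _*_ (cong (_^ m) (arrange m T)) (sym (^-*-assoc D (2 * T) m)) ⟩
  (D + 2 * T) ^ m * (D ^ (2 * T)) ^ m            ≡⟨ ^-distribʳ-* m (D + 2 * T) _ ⟨
  ((D + 2 * T) * D ^ (2 * T)) ^ m                ≤⟨ ^-monoˡ-≤ m (bernoulli D (2 * T)) ⟩
  (D * suc D ^ (2 * T)) ^ m                      ≡⟨ ^-distribʳ-* m D _ ⟩
  D ^ m * (suc D ^ (2 * T)) ^ m                  ≡⟨ cong (D ^ m *_) (trans (^-*-assoc (suc D) (2 * T) m) (cong (suc D ^_) (*-comm (2 * T) m))) ⟩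
  D ^ m * suc D ^ (m * (2 * T))                  ≤⟨ *-monoʳ-≤ (D ^ m) (⊑-* (2 * T) {m} {2} (half⊑2 m)) ⟩
  D ^ m * (2 ^ (2 * T) * D ^ (m * (2 * T)))      ≡⟨ cong₂ (λ x y → x * (y * D ^ (m * (2 * T)))) D^m (sym (^-*-assoc 2 2 T)) ⟩
  2 ^ m * m ^ m * (4 ^ T * D ^ (m * (2 * T)))    ≡⟨ cong (λ e → 2 ^ m * m ^ m * (4 ^ T * D ^ e)) (*-comm m (2 * T)) ⟩
  2 ^ m * m ^ m * (4 ^ T * D ^ (2 * T * m))      ≡⟨ arrange′ (2 ^ m) (m ^ m) (4 ^ T) _ ⟩
  2 ^ m * (4 ^ T * m ^ m) * D ^ (2 * T * m)      ∎))
  where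
  open ≤-Reasoning
  D = m + m
  instance
    D≢0 : NonZero D
    D≢0 = >-nonZero (≤-trans (>-nonZero⁻¹ m) (m≤m+n m m))
  open Exponent D using (⊑-*)
  arrange : ∀ m T → 2 * (m + T) ≡ m + m + 2 * T
  arrange = solve-∀
  arrange′ : ∀ a b c d → a * b * (c * d) ≡ a * (c * b) * d
  arrange′ = solve-∀
  D^m : D ^ m ≡ 2 ^ m * m ^ m
  D^m = trans (cong (_^ m) (cong (λ k → m + k) (sym (+-identityʳ m)))) (^-distribʳ-* m 2 m)

ι : ℕ → ℚ
ι n = + n ℚ./ 1

private
  ι≡mkℚ : ∀ n → ι n ≡ mkℚ (+ n) 0 (coprime-sym (1-coprimeTo n))
  ι≡mkℚ n = ℚ.↥p/↧p≡p (mkℚ (+ n) 0 (coprime-sym (1-coprimeTo n)))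

ι-* : ∀ m n → ι (m * n) ≡ ι m ℚ.* ι n
ι-* m n = trans (cong (ℚ._/ 1) (ℤ.pos-* m n)) (sym (cong₂ ℚ._*_ (ι≡mkℚ m) (ι≡mkℚ n)))

ι-+ : ∀ m n → ι (m + n) ≡ ι m ℚ.+ ι n
ι-+ m n = trans (cong (ℚ._/ 1) (sym (cong₂ ℤ._+_ (ℤ.*-identityʳ (+ m)) (ℤ.*-identityʳ (+ n)))))
  (sym (cong₂ ℚ._+_ (ι≡mkℚ m) (ι≡mkℚ n)))

ι-mono-≤ : ∀ {m n} → m ≤ n → ι m ℚ.≤ ι n
ι-mono-≤ {m} {n} m≤n = subst₂ ℚ._≤_ (sym (ι≡mkℚ m)) (sym (ι≡mkℚ n))
  (*≤* (subst₂ ℤ._≤_ (sym (ℤ.*-identityʳ (+ m))) (sym (ℤ.*-identityʳ (+ n))) (ℤ.+≤+ m≤n)))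

0≤ι : ∀ n → 0ℚ ℚ.≤ ι n
0≤ι n = ι-mono-≤ {0} {n} z≤n

ι⁻¹ : ∀ n .{{_ : NonZero n}} → ℚ
ι⁻¹ n = + 1 ℚ./ n

ι-inverse : ∀ n .{{_ : NonZero n}} → ι n ℚ.* ι⁻¹ n ≡ 1ℚ
ι-inverse (suc k) = trans (cong₂ ℚ._*_ (ι≡mkℚ (suc k)) (ℚ.↥p/↧p≡p (ℚ.1/ p))) (ℚ.*-inverseʳ p)
  where
  p : ℚ
  p = mkℚ (+ suc k) 0 (coprime-sym (1-coprimeTo (suc k)))

0≤ι⁻¹ : ∀ n .{{_ : NonZero n}} → 0ℚ ℚ.≤ ι⁻¹ n
0≤ι⁻¹ n = ℚ.nonNegative⁻¹ (ι⁻¹ n) {{ℚ.normalize-nonNeg 1 n}}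

*-mono-≤-0≤ : ∀ {a b c d} → 0ℚ ℚ.≤ a → a ℚ.≤ b → 0ℚ ℚ.≤ c → c ℚ.≤ d → a ℚ.* c ℚ.≤ b ℚ.* d
*-mono-≤-0≤ {a} {b} {c} {d} 0≤a a≤b 0≤c c≤d = ℚ.≤-trans
  (ℚ.*-monoʳ-≤-nonNeg c {{ℚ.nonNegative 0≤c}} a≤b)
  (ℚ.*-monoˡ-≤-nonNeg b {{ℚ.nonNegative (ℚ.≤-trans 0≤a a≤b)}} c≤d)

0≤* : ∀ {a b} → 0ℚ ℚ.≤ a → 0ℚ ℚ.≤ b → 0ℚ ℚ.≤ a ℚ.* b
0≤* {a} {b} 0≤a 0≤b = subst (ℚ._≤ a ℚ.* b) (ℚ.*-zeroˡ 0ℚ) (*-mono-≤-0≤ ℚ.≤-refl 0≤a ℚ.≤-refl 0≤b)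

0≤^ : ∀ {x} → 0ℚ ℚ.≤ x → ∀ k → 0ℚ ℚ.≤ x Defs.^ k
0≤^ 0≤x zero    = 0≤ι 1
0≤^ 0≤x (suc k) = 0≤* 0≤x (0≤^ 0≤x k)

^-mono-≤-0≤ : ∀ {x y} → 0ℚ ℚ.≤ x → x ℚ.≤ y → ∀ k → x Defs.^ k ℚ.≤ y Defs.^ k
^-mono-≤-0≤ 0≤x x≤y zero    = ℚ.≤-refl
^-mono-≤-0≤ 0≤x x≤y (suc k) = *-mono-≤-0≤ 0≤x x≤y (0≤^ 0≤x k) (^-mono-≤-0≤ 0≤x x≤y k)

ι-^ : ∀ m k → ι (m ^ k) ≡ ι m Defs.^ k
ι-^ m zero    = refl
ι-^ m (suc k) = trans (ι-* m (m ^ k)) (cong (ι m ℚ.*_) (ι-^ m k))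

1^ : ∀ k → 1ℚ Defs.^ k ≡ 1ℚ
1^ zero    = refl
1^ (suc k) = trans (ℚ.*-identityˡ _) (1^ k)

-- In effect e^q ≤ 4^T, since the bound holds for every approximant (1 + q/m)^m.
exp-lower : ∀ {q r} T → q ℚ.≤ ι T → lower (exp q) r → r ℚ.< ι (4 ^ T)
exp-lower {q} {r} T q≤T (k , 0<base , r<) = ℚ.<-≤-trans r< (begin
  (1ℚ ℚ.+ q ℚ.* w) Defs.^ m                   ≤⟨ ^-mono-≤-0≤ (ℚ.<⇒≤ 0<base) base≤ m ⟩
  (ι (m + T) ℚ.* w) Defs.^ m                  ≡⟨ Exp.^-distrib-* (ι (m + T)) w m ⟩
  ι (m + T) Defs.^ m ℚ.* w Defs.^ m           ≡⟨ cong (ℚ._* w Defs.^ m) (ι-^ (m + T) m) ⟨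
  ι ((m + T) ^ m) ℚ.* w Defs.^ m              ≤⟨ ℚ.*-monoʳ-≤-nonNeg (w Defs.^ m) {{ℚ.nonNegative (0≤^ (0≤ι⁻¹ m) m)}} (ι-mono-≤ ([1+T/m]^m≤4^T m T)) ⟩
  ι (4 ^ T * m ^ m) ℚ.* w Defs.^ m            ≡⟨ cong (ℚ._* w Defs.^ m) (trans (ι-* (4 ^ T) (m ^ m)) (cong (ι (4 ^ T) ℚ.*_) (ι-^ m m))) ⟩
  ι (4 ^ T) ℚ.* ι m Defs.^ m ℚ.* w Defs.^ m   ≡⟨ ℚ.*-assoc (ι (4 ^ T)) _ _ ⟩
  ι (4 ^ T) ℚ.* (ι m Defs.^ m ℚ.* w Defs.^ m) ≡⟨ cong (ι (4 ^ T) ℚ.*_) (trans (sym (Exp.^-distrib-* (ι m) w m)) (trans (cong (Defs._^ m) (ι-inverse m)) (1^ m))) ⟩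
  ι (4 ^ T) ℚ.* 1ℚ                            ≡⟨ ℚ.*-identityʳ _ ⟩
  ι (4 ^ T)                                   ∎)
  where
  open ℚ.≤-Reasoning
  m = suc k
  w = ι⁻¹ m
  base≤ : 1ℚ ℚ.+ q ℚ.* w ℚ.≤ ι (m + T) ℚ.* w
  base≤ = begin
    1ℚ ℚ.+ q ℚ.* w                ≤⟨ ℚ.+-monoʳ-≤ 1ℚ (ℚ.*-monoʳ-≤-nonNeg w {{ℚ.nonNegative (0≤ι⁻¹ m)}} q≤T) ⟩
    1ℚ ℚ.+ ι T ℚ.* w              ≡⟨ cong (ℚ._+ ι T ℚ.* w) (ι-inverse m) ⟨
    ι m ℚ.* w ℚ.+ ι T ℚ.* w       ≡⟨ ℚ.*-distribʳ-+ w (ι m) (ι T) ⟨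
    (ι m ℚ.+ ι T) ℚ.* w           ≡⟨ cong (ℚ._* w) (ι-+ m T) ⟨
    ι (m + T) ℚ.* w               ∎

-- As e^e^a ≤ 4^4^a ≤ n, no rational below a can exceed log log n. A lower bound for log log n is
-- what bounds n/(log log n)^d from above.
loglog-upper : ∀ a n → 4 ^ 4 ^ a ≤ n → ∀ {b} → upper (log (log (fromℕ n))) b → ι a ℚ.≤ b
loglog-upper a n h {b} (s , (u , n<u , u<exp) , s<exp) = ℚ.≮⇒≥ λ b<a →
  ℚ.<-irrefl refl (ℚ.<-trans n<u (ℚ.<-≤-trans
    (exp-lower (4 ^ a) (ℚ.<⇒≤ (exp-lower a (ℚ.<⇒≤ b<a) s<exp)) u<exp)
    (ι-mono-≤ h)))

^ℝ-upper : ∀ x a → (∀ {b} → upper x b → ι a ℚ.≤ b) → ∀ k {r} → upper (x ^ℝ k) r → ι (a ^ k) ℚ.≤ r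
^ℝ-upper x a h zero    1<r = ℚ.<⇒≤ 1<r
^ℝ-upper x a h (suc k) {r} (_ , b , _ , d , (_ , xb , _ , yd) , _ , _ , _ , bd<r) = begin
  ι (a * a ^ k)         ≡⟨ ι-* a (a ^ k) ⟩
  ι a ℚ.* ι (a ^ k)     ≤⟨ *-mono-≤-0≤ (0≤ι a) (h xb) (0≤ι (a ^ k)) (^ℝ-upper x a h k yd) ⟩
  b ℚ.* d               <⟨ bd<r ⟩
  r                     ∎
  where open ℚ.≤-Reasoning

-- The corner a c is at most X Y when c ≥ 0; the corner b c is at most 0 when c ≤ 0.
*ℝ-lower : ∀ x y {X Y} → 0ℚ ℚ.≤ X → 0ℚ ℚ.≤ Y → (∀ {a} → lower x a → a ℚ.≤ X) → (∀ {b} → upper x b → 0ℚ ℚ.≤ b) →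
           (∀ {c} → lower y c → c ℚ.≤ Y) → ∀ {q} → lower (x *ℝ y) q → q ℚ.< X ℚ.* Y
*ℝ-lower x y {X} {Y} 0≤X 0≤Y x≤ 0≤x y≤ {q} (a , b , c , d , (xa , xb , yc , yd) , q<ac , _ , q<bc , _) with ℚ.≤-total c 0ℚ
... | inj₁ c≤0 = ℚ.<-≤-trans q<bc (ℚ.≤-trans
  (subst (b ℚ.* c ℚ.≤_) (ℚ.*-zeroʳ b) (ℚ.*-monoˡ-≤-nonNeg b {{ℚ.nonNegative (0≤x xb)}} c≤0)) (0≤* 0≤X 0≤Y))
... | inj₂ 0≤c = ℚ.<-≤-trans q<ac (ℚ.≤-trans
  (ℚ.*-monoʳ-≤-nonNeg c {{ℚ.nonNegative 0≤c}} (x≤ xa)) (*-mono-≤-0≤ 0≤X ℚ.≤-refl 0≤c (y≤ yc)))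

recip-lower : ∀ y m .{{_ : NonZero m}} → (∀ {r} → upper y r → ι m ℚ.≤ r) → ∀ {c} → lower (recip y) c → c ℚ.≤ ι⁻¹ m
recip-lower y m h {c} (r , 0<r , yr , cr<1) with ℚ.≤-total c 0ℚ
... | inj₁ c≤0 = ℚ.≤-trans c≤0 (0≤ι⁻¹ m)
... | inj₂ 0≤c = begin
  c                             ≡⟨ ℚ.*-identityʳ c ⟨
  c ℚ.* 1ℚ                      ≡⟨ cong (c ℚ.*_) (ι-inverse m) ⟨
  c ℚ.* (ι m ℚ.* ι⁻¹ m)         ≡⟨ ℚ.*-assoc c (ι m) _ ⟨
  c ℚ.* ι m ℚ.* ι⁻¹ m           ≤⟨ ℚ.*-monoʳ-≤-nonNeg (ι⁻¹ m) {{ℚ.nonNegative (0≤ι⁻¹ m)}}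
                                    (ℚ.≤-trans (ℚ.*-monoˡ-≤-nonNeg c {{ℚ.nonNegative 0≤c}} (h yr)) (ℚ.<⇒≤ cr<1)) ⟩
  1ℚ ℚ.* ι⁻¹ m                  ≡⟨ ℚ.*-identityˡ _ ⟩
  ι⁻¹ m                         ∎
  where open ℚ.≤-Reasoning

fromℚ-isReal : ∀ p → IsReal (fromℚ p)
fromℚ-isReal p = record
  { lower-inhabited = p ℚ.- 1ℚ , subst (p ℚ.- 1ℚ ℚ.<_) (ℚ.+-identityʳ p) (ℚ.+-monoʳ-< p -1<0)
  ; upper-inhabited = p ℚ.+ 1ℚ , subst (ℚ._< p ℚ.+ 1ℚ) (ℚ.+-identityʳ p) (ℚ.+-monoʳ-< p 0<1)
  ; lower-closed    = ℚ.<-trans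
  ; upper-closed    = λ q<r p<q → ℚ.<-trans p<q q<r
  ; lower-open      = λ q<p → let r , q<r , r<p = ℚ.<-dense q<p in r , q<r , r<p
  ; upper-open      = λ p<q → let r , p<r , r<q = ℚ.<-dense p<q in r , r<q , p<r
  ; disjoint        = λ q<p p<q → ℚ.<-asym q<p p<q
  ; located         = λ {q} {r} q<r → located q<r (q ℚ.<? p)
  }
  where
  -1<0 : ℚ.- 1ℚ ℚ.< 0ℚ
  -1<0 = *<* ℤ.-<+
  0<1 : 0ℚ ℚ.< 1ℚ
  0<1 = *<* (ℤ.+<+ (s≤s z≤n))
  located : ∀ {q r} → q ℚ.< r → Dec (q ℚ.< p) → q ℚ.< p ⊎ p ℚ.< r
  located q<r (yes q<p) = inj₁ q<p
  located q<r (no q≮p)  = inj₂ (ℚ.≤-<-trans (ℚ.≮⇒≥ q≮p) q<r)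

real-bound : ∀ K .{{_ : NonZero K}} d a .{{_ : NonZero a}} {n δ} → 4 ^ 4 ^ a ≤ n → n ≤ K * (a ^ d * δ) →
           fromℚ (ι⁻¹ K) *ℝ (fromℕ n /ℝ log (log (fromℕ n)) ^ℝ d) ≤ℝ fromℤ (+ δ)
real-bound K d a {n} {δ} 4^4^a≤n n≤ {q} q∈ = ℚ.<-≤-trans
  (*ℝ-lower (fromℚ (ι⁻¹ K)) (fromℕ n *ℝ recip L) (0≤ι⁻¹ K) (0≤* (0≤ι n) (0≤ι⁻¹ A)) ℚ.<⇒≤ (λ b> → ℚ.<⇒≤ (ℚ.≤-<-trans (0≤ι⁻¹ K) b>))
    (λ c∈ → ℚ.<⇒≤ (*ℝ-lower (fromℕ n) (recip L) (0≤ι n) (0≤ι⁻¹ A) ℚ.<⇒≤ (λ b> → ℚ.<⇒≤ (ℚ.≤-<-trans (0≤ι n) b>))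
      (recip-lower L A (^ℝ-upper (log (log (fromℕ n))) a (loglog-upper a n 4^4^a≤n) d)) c∈))
    q∈)
  (begin
    ι⁻¹ K ℚ.* (ι n ℚ.* ι⁻¹ A)              ≤⟨ *-mono-≤-0≤ (0≤ι⁻¹ K) ℚ.≤-refl (0≤* (0≤ι n) (0≤ι⁻¹ A)) (ℚ.*-monoʳ-≤-nonNeg (ι⁻¹ A) {{ℚ.nonNegative (0≤ι⁻¹ A)}} (ι-mono-≤ n≤KδA)) ⟩
    ι⁻¹ K ℚ.* (ι (K * (δ * A)) ℚ.* ι⁻¹ A)  ≡⟨ cong (λ v → ι⁻¹ K ℚ.* (v ℚ.* ι⁻¹ A)) (trans (ι-* K (δ * A)) (cong (ι K ℚ.*_) (ι-* δ A))) ⟩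
    ι⁻¹ K ℚ.* (ι K ℚ.* (ι δ ℚ.* ι A) ℚ.* ι⁻¹ A) ≡⟨ cong (ι⁻¹ K ℚ.*_) (trans (ℚ.*-assoc (ι K) _ _) (cong (ι K ℚ.*_) (trans (ℚ.*-assoc (ι δ) (ι A) (ι⁻¹ A)) (trans (cong (ι δ ℚ.*_) (ι-inverse A)) (ℚ.*-identityʳ (ι δ)))))) ⟩
    ι⁻¹ K ℚ.* (ι K ℚ.* ι δ)                ≡⟨ ℚ.*-assoc (ι⁻¹ K) (ι K) (ι δ) ⟨
    ι⁻¹ K ℚ.* ι K ℚ.* ι δ                  ≡⟨ cong (ℚ._* ι δ) (trans (ℚ.*-comm (ι⁻¹ K) (ι K)) (ι-inverse K)) ⟩
    1ℚ ℚ.* ι δ                             ≡⟨ ℚ.*-identityˡ (ι δ) ⟩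
    ι δ                                    ∎)
  where
  open ℚ.≤-Reasoning
  L = log (log (fromℕ n)) ^ℝ d
  A = a ^ d
  instance
    A≢0 : NonZero A
    A≢0 = m^n≢0 a d
  n≤KδA : n ≤ K * (δ * A)
  n≤KδA = subst (λ v → n ≤ K * v) (*-comm A δ) n≤

-- Choice of the scale and conclusion

bracket : ∀ (f : ℕ → ℕ) → (∀ a → a < f a) → ∀ {a₀ n} → f a₀ ≤ n → ∃[ a ] a₀ ≤ a × f a ≤ n × n < f (suc a)
-- Every a reached satisfies a < f a ≤ n, so the fuel `suc n` is enough.
bracket f a<fa {a₀} {n} fa₀≤n = go (suc n) a₀ ≤-refl fa₀≤n (m≤n+m (suc n) a₀)
  where
  go : ∀ fuel a → a₀ ≤ a → f a ≤ n → n < a + fuel → ∃[ a ] a₀ ≤ a × f a ≤ n × n < f (suc a)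
  go zero       a a₀≤a fa≤n n<a = contradiction (<-≤-trans (a<fa a) fa≤n) (<⇒≱ (subst (n <_) (+-identityʳ a) n<a) ∘ <⇒≤)
  go (suc fuel) a a₀≤a fa≤n n<  with n <? f (suc a)
  ... | yes n<f = a , a₀≤a , fa≤n , n<f
  ... | no  n≮f = go fuel (suc a) (m≤n⇒m≤1+n a₀≤a) (≮⇒≥ n≮f) (subst (n <_) (+-suc a fuel) n<)

-- With Z = 4^(a + 1) the value at a is 4^(4Z) and the next one 4^(16Z), the range required of n in
-- `Count`. Opaque, as the value at 255 is far beyond computation.
abstract
  scale : ℕ → ℕ
  scale a = 4 ^ (4 * 4 ^ suc a)

  scale-def : ∀ a → scale a ≡ 4 ^ (4 * 4 ^ suc a)
  scale-def a = refl

a<scale : ∀ a → a < scale a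
a<scale a = begin-strict
  a                     <⟨ n<1+n a ⟩
  suc a                 ≤⟨ <⇒≤ (n<4^n (suc a)) ⟩
  4 ^ suc a             ≤⟨ m≤n*m (4 ^ suc a) 4 ⟩
  4 * 4 ^ suc a         ≤⟨ <⇒≤ (n<4^n (4 * 4 ^ suc a)) ⟩
  4 ^ (4 * 4 ^ suc a)   ≡⟨ scale-def a ⟨
  scale a               ∎
  where open ≤-Reasoning

4*4*Z≡16*Z : ∀ Z → 4 * (4 * Z) ≡ 16 * Z
4*4*Z≡16*Z = solve-∀

-- The `suc` makes the constant visibly nonzero although `gapConst` is opaque, so that its
-- reciprocal can serve as c.
commonConst : ℕ
commonConst = suc (gapConst 2 2 + gapConst 6 4)

E-M≡δ : ∀ {e M} δ → e ≡ M + δ → + e - + M ≡ + δ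
E-M≡δ {e} {M} δ refl = trans (cong (λ z → z - + M) (ℤ.+-comm (+ M) (+ δ))) (trans (ℤ.+-assoc (+ δ) (+ M) (ℤ.- (+ M)))
  (trans (cong (λ z → + δ ℤ.+ z) (ℤ.+-inverseʳ (+ M))) (ℤ.+-identityʳ (+ δ))))

-- The hypothesis on all A is applied to one that attains the maximum.
bound-from-gap : ∀ k d → (∀ (j : Fin k) → nthPrime (toℕ j) ∤ 1) → 1 ≤ k → ∀ n a → 1 ≤ n → 4 ^ 4 ^ suc a ≤ n →
  (∀ A → C k n A → A ⊈ E k n → ∃[ δ ] ∣ E k n ∣ ≡ ∣ A ∣ + δ × n ≤ commonConst * (suc a ^ d * δ)) →
  ∃[ M ] IsMaxCard (λ A → C k n A × A ⊈ E k n) M ×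
    fromℚ (ι⁻¹ commonConst) *ℝ (fromℕ n /ℝ log (log (fromℕ n)) ^ℝ d) ≤ℝ fromℤ (+ ∣ E k n ∣ - + M)
bound-from-gap k d ∤1 1≤k n a 1≤n a-small g with exists-max k n ∤1 1≤k 1≤n
... | M , ((A , (cA , A⊈) , refl) , bound) with g A cA A⊈
...   | δ , E≡ , n≤ = M , ((A , (cA , A⊈) , refl) , bound) ,
  subst (λ z → fromℚ (ι⁻¹ commonConst) *ℝ (fromℕ n /ℝ log (log (fromℕ n)) ^ℝ d) ≤ℝ fromℤ z) (sym (E-M≡δ δ E≡))
    (real-bound commonConst d (suc a) a-small n≤)

maxGap : (k d n : ℕ) → Cut → Set
maxGap k d n c = ∃[ M ] IsMaxCard (λ A → C k n A × A ⊈ E k n) M ×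
  c *ℝ (fromℕ n /ℝ log (log (fromℕ n)) ^ℝ d) ≤ℝ fromℤ (+ ∣ E k n ∣ - + M)

weaken : ∀ {e A n K K′ w w′} → K ≤ K′ → w ≤ w′ →
         ∃[ δ ] e ≡ A + δ × n ≤ K * (w * δ) → ∃[ δ ] e ≡ A + δ × n ≤ K′ * (w′ * δ)
weaken K≤ w≤ (δ , e≡ , n≤) = δ , e≡ , ≤-trans n≤ (*-mono-≤ K≤ (*-monoˡ-≤ δ w≤))

-- 255 ≤ a is 64 d ≤ `suc a` for the larger d = 4.
gaps : ∀ n a {Z} → Z ≡ 4 ^ suc a → 255 ≤ a → 4 ^ (4 * Z) ≤ n → n < 4 ^ (16 * Z) →
       maxGap 1 2 n (fromℚ (ι⁻¹ commonConst)) × maxGap 2 5 n (fromℚ (ι⁻¹ commonConst))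
gaps n a {Z} Z≡ 255≤a lower-n upper-n =
    bound-from-gap 1 2 (λ { Fin.zero 2∣1 → prime≢1 prime[2] 2∣1 }) ≤-refl n a 1≤n a-small gap-E₁
  , bound-from-gap 2 5 (λ { Fin.zero 2∣1 → prime≢1 prime[2] 2∣1 ; (Fin.suc Fin.zero) 3∣1 → <⇒≱ (s≤s (s≤s z≤n)) (∣⇒≤ 3∣1) }) (s≤s z≤n) n a 1≤n a-small gap-E₂
  where
  1≤n : 1 ≤ n
  1≤n = ≤-trans (m^n>0 4 (4 * Z)) lower-n
  a-small : 4 ^ 4 ^ suc a ≤ n
  a-small = subst (λ z → 4 ^ z ≤ n) Z≡ (≤-trans (^-monoʳ-≤ 4 (m≤n*m Z 4)) lower-n)
  gap-E₁ : ∀ A → C 1 n A → A ⊈ E 1 n → ∃[ δ ] ∣ E 1 n ∣ ≡ ∣ A ∣ + δ × n ≤ commonConst * (suc a ^ 2 * δ)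
  gap-E₁ A cA A⊈ = weaken {w = suc a ^ 2} {w′ = suc a ^ 2} (m≤n⇒m≤1+n (m≤m+n (gapConst 2 2) (gapConst 6 4))) ≤-refl
    (gap₁ A cA A⊈ a (≤-trans (m≤m+n 128 128) (s≤s 255≤a)) Z≡ lower-n upper-n)
  gap-E₂ : ∀ A → C 2 n A → A ⊈ E 2 n → ∃[ δ ] ∣ E 2 n ∣ ≡ ∣ A ∣ + δ × n ≤ commonConst * (suc a ^ 5 * δ)
  gap-E₂ A cA A⊈ = weaken {w = suc a ^ 4} {w′ = suc a ^ 5} (m≤n⇒m≤1+n (m≤n+m (gapConst 6 4) (gapConst 2 2))) (m≤n*m (suc a ^ 4) (suc a))
    (gap₂ A cA A⊈ a (s≤s 255≤a) Z≡ lower-n upper-n)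

theorem3 : ∃[ c ] IsReal c × fromℚ 0ℚ <ℝ c × (∃[ n₀ ] (∀ n → n₀ ≤ n →
    (∃[ M ] IsMaxCard (λ A → C 1 n A × A ⊈ E 1 n) M ×
    c *ℝ (fromℕ n /ℝ log (log (fromℕ n)) ^ℝ 2) ≤ℝ fromℤ (+ ∣ E 1 n ∣ - + M))
    ×
    (∃[ M ] IsMaxCard (λ A → C 2 n A × A ⊈ E 2 n) M ×
    c *ℝ (fromℕ n /ℝ log (log (fromℕ n)) ^ℝ 5) ≤ℝ fromℤ (+ ∣ E 2 n ∣ - + M))))
theorem3 = fromℚ c , fromℚ-isReal c , ℚ.<-dense (ℚ.positive⁻¹ c {{ℚ.normalize-pos 1 commonConst}}) , scale 255 , λ n n₀≤n →
  let a , 255≤a , scale≤n , n<scale = bracket scale a<scale n₀≤n in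
  gaps n a refl 255≤a (subst (_≤ n) (scale-def a) scale≤n)
    (subst (n <_) (trans (scale-def (suc a)) (cong (4 ^_) (4*4*Z≡16*Z (4 ^ suc a)))) n<scale)
  where
  c : ℚ
  c = ι⁻¹ commonConst
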